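{- Let $|N|\ge 2$, $x\in N$, $M:=N\setminus x$ and $r\in\mathbb{R}^{\mathcal{P}(M)}$. Let $m=T_{u\text{ -mod}}(r)\in\mathbb{R}^{\mathcal{P}(N)}$ be the upper modular extension of $r$. (i) One has $m\in\mathcal{K}(N)$ if and only if $r\in\mathcal{K}(M)$. The independency model induced by $m$ is then determined as follows: given $\langle a,b|C\rangle\in\mathcal{E}(N)$, one has $a\perp b\mid C\ [m]$ if and only if one of the following holds: - $x\in C$; - $x\in\{a,b\}$ and $r_u((a\cup b\cup C)\setminus x)=r_u(C)$; - $x\notin a\cup b\cup C$ and $a\perp b\mid C\ [r]$. (ii) The function $r$ is extreme in $\mathcal{K}(M)$ if and only if $m=T_{u\text{ -mod}}(r)$ is extreme in $\mathcal{K}(N)$.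
   Context: $N$ is a finite set and $\mathcal{P}(N)$ is its power set; a singleton $\{a\}$ is written $a$. $\mathbb{R}^{\mathcal{P}(N)}$ is the space of functions $m:\mathcal{P}(N)\to\mathbb{R}$ with scalar product $\langle m,u\rangle=\sum_{A\subseteq N}m(A)u(A)$. A function $m$ is supermodular if $m(A)+m(B)\le m(A\cup B)+m(A\cap B)$ for all $A,B\subseteq N$; $\mathcal{K}(N)$ is the cone of supermodular functions. $\mathcal{E}(N)$ is the set of triplets $\langle a,b|C\rangle$ with $a,b\in N$ distinct and $C\subseteq N\setminus\{a,b\}$. For $m\in\mathbb{R}^{\mathcal{P}(N)}$, $a\perp b\mid C\ [m]$ means $m(a\cup b\cup C)+m(C)-m(a\cup C)-m(b\cup C)=0$; the independency model induced by $m\in\mathcal{K}(N)$ is the set of $\langle a,b|C\rangle\in\mathcal{E}(N)$ with $a\perp b\mid C\ [m]$. A face of a convex cone $K\subseteq\mathbb{R}^{\mathcal{P}(N)}$ is a set $\{m\in K: k=\langle m,v\rangle\}$, where $v\in\mathbb{R}^{\mathcal{P}(N)}$, $k\in\mathbb{R}$ satisfy $k\le\langle m,v\rangle$ for all $m\in K$. The non-empty faces of $\mathcal{K}(N)$ form a lattice under inclusion with least element the space of modular functions $\mathcal{K}(N)\cap(-\mathcal{K}(N))$. A function is extreme in $\mathcal{K}(N)$ if it belongs to $\mathcal{K}(N)$ and the smallest face of $\mathcal{K}(N)$ containing it is an atom of this lattice. The same definitions are used for other finite sets in place of $N$. For $r\in\mathbb{R}^{\mathcal{P}(M)}$ the upper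 standardization is $r_u(T)=r(T)+(|M|-1)\,r(M)-\sum_{j\in M}r(M\setminus j)+\sum_{i\in T}[r(M\setminus i)-r(M)]$ for $T\subseteq M$. For $\emptyset\ne M\subsetneq N$ the upper modular extension $T_{u\text{ -mod}}:\mathbb{R}^{\mathcal{P}(M)}\to\mathbb{R}^{\mathcal{P}(N)}$ is defined, for $S\subseteq N$, by $[T_{u\text{ -mod}}(r)](S)=r(S)$ if $S\subseteq M$, and $[T_{u\text{ -mod}}(r)](S)=r(S\cap M)-r_u(S\cap M)$ otherwise. -}

module Defs where

open import Algebra.Bundles using (CommutativeRing)
import Algebra.Definitions.RawMonoid as RawMonoid
open import Data.Bool.Base using (if_then_else_)
open import Data.Fin.Base using (Fin)
open import Data.Fin.Subset
  using (Subset; inside; outside; _∈_; _∉_; _⊆_; _∪_; _∩_; _─_; ⁅_⁆; ∣_∣)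
import Data.Fin.Subset as Subset
open import Data.Fin.Subset.Properties
  using (_∈?_; _⊆?_; x∈p∪q⁻; x∈p∩q⁻; p∩q⊆q; x∈p∧x≢y⇒x∈p-y; p─q⊆p;
         x∈⁅y⁆⇒x≡y; x∈p∪q⁺; x∈⁅x⁆)
open import Data.List.Base using (List; []; _∷_; _++_; map; mapMaybe; foldr)
open import Data.Maybe.Base using (Maybe; just; nothing)
open import Data.Nat.Base using (ℕ; zero; suc)
open import Data.Product.Base using (∃; ∃-syntax; _×_; _,_; proj₁)
open import Data.Sum.Base using (_⊎_; inj₁; inj₂; [_,_]′)
open import Data.Vec.Base using ([]; _∷_; here; there)
open import Function.Base using (id)
open import Level using (Level; 0ℓ)
import Level
open import Relation.Binary.Bundles using (Poset)
open import Relation.Binary.Core using (Rel)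
open import Relation.Binary.Definitions using (Minimum)
open import Relation.Binary.PropositionalEquality using (_≡_; _≢_; refl; subst; sym)
open import Relation.Binary.Structures using (IsDecTotalOrder)
import Relation.Binary.Construct.On as On
open import Relation.Nullary.Decidable.Core using (yes; no; does; recompute)
open import Relation.Nullary.Negation.Core using (¬_)
open import Relation.Unary using (Pred)
open import Relation.Unary.Relation.Binary.Subset using (⊆-poset)

-- The standard library has no type of real numbers.  They are given by
-- their axioms: a (Dedekind-)complete totally ordered field, which is
-- classically unique up to isomorphism.  The order is decidable, as it
-- is for the reals of classical mathematics.
record RealNumbers : Set₁ where
  infix 4 _≤_
  field
    commutativeRing : CommutativeRing 0ℓ 0ℓ

  open CommutativeRing commutativeRing public

  field
    0≉1     : ¬ (0# ≈ 1#)
    inverse : ∀ x → ¬ (x ≈ 0#) → ∃[ y ] x * y ≈ 1#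

    _≤_             : Rel Carrier 0ℓ
    isDecTotalOrder : IsDecTotalOrder _≈_ _≤_
    +-monoˡ-≤       : ∀ {x y} z → x ≤ y → x + z ≤ y + z
    *-nonneg        : ∀ {x y} → 0# ≤ x → 0# ≤ y → 0# ≤ x * y

  UpperBound : Pred Carrier 0ℓ → Pred Carrier 0ℓ
  UpperBound P b = ∀ {x} → P x → x ≤ b

  field
    supremum : (P : Pred Carrier 0ℓ) → ∃ P → ∃ (UpperBound P) →
               ∃[ s ] UpperBound P s × (∀ {b} → UpperBound P b → s ≤ b)

module _ {c ℓ₁ ℓ₂ : Level} (P : Poset c ℓ₁ ℓ₂) where
  open Poset P

  IsLeast : Pred Carrier (c Level.⊔ ℓ₂)
  IsLeast = Minimum _≤_

  -- Nothing lies strictly between the least element and a.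
  IsAtom : Pred Carrier (c Level.⊔ ℓ₁ Level.⊔ ℓ₂)
  IsAtom a = ¬ IsLeast a × (∀ b → b ≤ a → IsLeast b ⊎ b ≈ a)

x∈p─q⇒x∉q : ∀ {n} {x : Fin n} (p q : Subset n) → x ∈ p ─ q → x ∉ q
x∈p─q⇒x∉q (_ ∷ p) (inside ∷ q) ()          here
x∈p─q⇒x∉q (_ ∷ p) (_      ∷ q) (there x∈─) (there x∈q) = x∈p─q⇒x∉q p q x∈─ x∈q

module _ {n : ℕ} where
  open Subset using (_-_)

  -- A finite set N is a subset of some Fin n; this way N and N - x are
  -- ground sets of the same kind.  The proof of inclusion is irrelevant,
  -- so that elements of 𝒫 N with the same underlying set are equal.
  infix 5 _⟨_⟩
  record 𝒫 (N : Subset n) : Set where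
    constructor _⟨_⟩
    field
      set   : Subset n
      .set⊆ : set ⊆ N

  open 𝒫 public

  infixr 7 _∩ₚ_
  infixr 6 _∪ₚ_

  _∪ₚ_ : {N : Subset n} → 𝒫 N → 𝒫 N → 𝒫 N
  (A ⟨ A⊆N ⟩) ∪ₚ (B ⟨ B⊆N ⟩) =
    (A ∪ B) ⟨ (λ i∈ → [ (λ i∈A → A⊆N i∈A) , (λ i∈B → B⊆N i∈B) ]′ (x∈p∪q⁻ A B i∈)) ⟩

  _∩ₚ_ : {N : Subset n} → 𝒫 N → 𝒫 N → 𝒫 N
  (A ⟨ A⊆N ⟩) ∩ₚ (B ⟨ B⊆N ⟩) = (A ∩ B) ⟨ (λ i∈ → A⊆N (proj₁ (x∈p∩q⁻ A B i∈))) ⟩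

  singleton : {N : Subset n} (a : Fin n) → .(a ∈ N) → 𝒫 N
  singleton {N} a a∈N =
    ⁅ a ⁆ ⟨ (λ i∈ → subst (_∈ N) (sym (x∈⁅y⁆⇒x≡y a i∈)) (recompute (a ∈? N) a∈N)) ⟩

  whole : (N : Subset n) → 𝒫 N
  whole N = N ⟨ id ⟩

  _without_ : (N : Subset n) → Fin n → 𝒫 N
  N without i = (N - i) ⟨ p─q⊆p N ⁅ i ⁆ ⟩

  meet : (M : Subset n) → Subset n → 𝒫 M
  meet M S = (S ∩ M) ⟨ p∩q⊆q S M ⟩

  infixl 7 _∖_
  _∖_ : {N : Subset n} → 𝒫 N → (x : Fin n) → 𝒫 (N - x)
  (A ⟨ A⊆N ⟩) ∖ x =
    (A - x) ⟨ (λ i∈ → x∈p∧x≢y⇒x∈p-y (A⊆N (p─q⊆p A ⁅ x ⁆ i∈))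
                        λ { refl → x∈p─q⇒x∉q A ⁅ x ⁆ i∈ (x∈⁅x⁆ x) }) ⟩

  -- For A ⊆ N and x ∉ A, the set A as a subset of N - x.
  narrow : {N : Subset n} {x : Fin n} (A : 𝒫 N) → .(x ∉ set A) → 𝒫 (N - x)
  narrow {N} (A ⟨ A⊆N ⟩) x∉A =
    A ⟨ (λ i∈A → x∈p∧x≢y⇒x∈p-y (A⊆N i∈A) λ { refl → x∉A i∈A }) ⟩

  -- The triplets ⟨ a , b ∣ C ⟩ of ℰ(N): C ⊆ N ∖ {a , b} is split into
  -- C ⊆ N, a ∉ C and b ∉ C.
  record Triplet (N : Subset n) : Set where
    field
      a b  : Fin n
      C    : 𝒫 N
      a∈N  : a ∈ N
      b∈N  : b ∈ N
      a≢b  : a ≢ b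
      a∉C  : a ∉ set C
      b∉C  : b ∉ set C

    aC bC abC : 𝒫 N
    aC  = singleton a a∈N ∪ₚ C
    bC  = singleton b b∈N ∪ₚ C
    abC = singleton a a∈N ∪ₚ singleton b b∈N ∪ₚ C

    x∈ab⇒x∉C : {x : Fin n} → x ∈ ⁅ a ⁆ ∪ ⁅ b ⁆ → x ∉ set C
    x∈ab⇒x∉C x∈ab x∈C with x∈p∪q⁻ ⁅ a ⁆ ⁅ b ⁆ x∈ab
    ... | inj₁ x∈a = a∉C (subst (_∈ set C) (x∈⁅y⁆⇒x≡y a x∈a) x∈C)
    ... | inj₂ x∈b = b∉C (subst (_∈ set C) (x∈⁅y⁆⇒x≡y b x∈b) x∈C)

  -- A triplet over N avoiding x, as a triplet over N - x.
  narrowTriplet : {N : Subset n} {x : Fin n} (t : Triplet N) →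
                  x ∉ set (Triplet.abC t) → Triplet (N - x)
  narrowTriplet {N} {x} t x∉abC = record
    { a   = a
    ; b   = b
    ; C   = narrow C (λ x∈C → x∉abC (x∈p∪q⁺ (inj₂ (x∈p∪q⁺ (inj₂ x∈C)))))
    ; a∈N = x∈p∧x≢y⇒x∈p-y a∈N λ { refl → x∉abC (x∈p∪q⁺ (inj₁ (x∈⁅x⁆ a))) }
    ; b∈N = x∈p∧x≢y⇒x∈p-y b∈N
              λ { refl → x∉abC (x∈p∪q⁺ (inj₂ (x∈p∪q⁺ (inj₁ (x∈⁅x⁆ b))))) }
    ; a≢b = a≢b
    ; a∉C = a∉C
    ; b∉C = b∉C
    }
    where open Triplet t

subsets : (n : ℕ) → List (Subset n)
subsets zero    = [] ∷ []
subsets (suc n) = map (outside ∷_) (subsets n) ++ map (inside ∷_) (subsets n)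

powerset : {n : ℕ} (N : Subset n) → List (𝒫 N)
powerset {n} N = mapMaybe asSubsetOfN (subsets n)
  where
  asSubsetOfN : Subset n → Maybe (𝒫 N)
  asSubsetOfN A with A ⊆? N
  ... | yes A⊆N = just (A ⟨ A⊆N ⟩)
  ... | no  _   = nothing

module SetFunctions (ℝ : RealNumbers) where
  open RealNumbers ℝ
  open RawMonoid +-rawMonoid using (sum) renaming (_×_ to _·ℕ_)

  module _ {n : ℕ} where

    ℝ^𝒫 : Subset n → Set
    ℝ^𝒫 N = 𝒫 N → Carrier

    ⟪_,_⟫ : {N : Subset n} → ℝ^𝒫 N → ℝ^𝒫 N → Carrier
    ⟪_,_⟫ {N} m u = foldr _+_ 0# (map (λ A → m A * u A) (powerset N))

    -- As a predicate on ℝ^𝒫 N, this is the convex cone 𝒦(N).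
    Supermodular : (N : Subset n) → Pred (ℝ^𝒫 N) 0ℓ
    Supermodular N m = ∀ A B → m A + m B ≤ m (A ∪ₚ B) + m (A ∩ₚ B)

    -- a ⊥ b ∣ C [ m ]
    Independent : {N : Subset n} → ℝ^𝒫 N → Triplet N → Set
    Independent m t = m abC + m C - m aC - m bC ≈ 0#
      where open Triplet t

    record NonemptyFace {N : Subset n} (K : Pred (ℝ^𝒫 N) 0ℓ) : Set where
      field
        v     : ℝ^𝒫 N
        k     : Carrier
        bound : ∀ {m} → K m → k ≤ ⟪ m , v ⟫

      members : Pred (ℝ^𝒫 N) 0ℓ
      members m = K m × k ≈ ⟪ m , v ⟫

      field
        nonempty : ∃ members

    open NonemptyFace using (members)

    -- Faces are compared as sets: (v , k) is not determined by the face.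
    facePoset : {N : Subset n} → Pred (ℝ^𝒫 N) 0ℓ → Poset 0ℓ 0ℓ 0ℓ
    facePoset {N} K = On.poset (⊆-poset (ℝ^𝒫 N) 0ℓ) (members {K = K})

    IsSmallestFaceContaining : {N : Subset n} (K : Pred (ℝ^𝒫 N) 0ℓ) →
                               ℝ^𝒫 N → Pred (NonemptyFace K) 0ℓ
    IsSmallestFaceContaining K m F =
      members F m × (∀ G → members G m → Poset._≤_ (facePoset K) F G)

    Extreme : (N : Subset n) → Pred (ℝ^𝒫 N) 0ℓ
    Extreme N m = Supermodular N m ×
      ∃[ F ] IsSmallestFaceContaining (Supermodular N) m F ×
             IsAtom (facePoset (Supermodular N)) F

    ∑∈ : Subset n → (Fin n → Carrier) → Carrier
    ∑∈ S f = sum λ i → if does (i ∈? S) then f i else 0#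

    -- The upper standardization r_u.
    upperStd : {M : Subset n} → ℝ^𝒫 M → ℝ^𝒫 M
    upperStd {M} r T =
      r T + (∣ M ∣ ·ℕ 1# - 1#) * r (whole M)
          - ∑∈ M (λ j → r (M without j))
          + ∑∈ (set T) (λ i → r (M without i) - r (whole M))

    -- Meant for ∅ ≠ M ⊊ N only; the formula itself does not need this.
    T-umod : {M N : Subset n} → ℝ^𝒫 M → ℝ^𝒫 N
    T-umod {M} r S with set S ⊆? M
    ... | yes S⊆M = r (set S ⟨ S⊆M ⟩)
    ... | no  _   = r (meet M (set S)) - upperStd r (meet M (set S))

{-# OPTIONS --safe #-}
module Submission where

-- Write D f A B for f(A ∪ B) + f(A ∩ B) - f(A) - f(B).  For m = T_u-mod(r), D m A B is D r A B
-- if x ∉ A ∪ B, it is 0 if x ∈ A ∩ B, and it is r_u(A ∩ B) - r_u(B) if x ∈ A only.  As r_u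
-- differs from r by a modular function and vanishes on M and on all M ∖ j, supermodularity of r
-- makes r_u antitone; this gives (i).
--
-- The smallest face of 𝒦(N) containing m consists of the m' ∈ 𝒦(N) with c m - m' ∈ 𝒦(N) for some
-- c; write m' ≼ m.  So m is extreme iff it is not modular and every m' ≼ m in 𝒦(N) is modular or
-- satisfies m ≼ m'.  The linear map T_u-mod preserves and reflects ≼ and modularity.  Conversely,
-- if m' ≼ T_u-mod(r), the pairs on which D (T_u-mod(r)) always vanishes force m' to differ from
-- T_u-mod(m'|M) by a multiple of the modular function A ↦ [x ∈ A]; this gives (ii).

open import Defs
open import Algebra.Bundles using (CommutativeRing)
import Algebra.Definitions.RawMonoid as RawMonoid
import Algebra.Properties.Ring as RingProperties
import Algebra.Properties.Semiring.Mult as Mult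
import Algebra.Solver.Ring as RingSolver
open import Algebra.Solver.Ring.AlmostCommutativeRing
  using (fromCommutativeRing; _-Raw-AlmostCommutative⟶_; Induced-equivalence)
open import Data.Bool.Base using (true; false; if_then_else_)
import Data.Bool.Properties as Bool
open import Data.Fin.Base using (Fin; zero; suc)
open import Data.Fin.Subset
  using (Subset; inside; outside; ⊥; ⁅_⁆; _∈_; _∉_; _⊆_; _⊂_; _∪_; _∩_; _─_; ∣_∣)
  renaming (_-_ to _-ₛ_)
open import Data.Fin.Subset.Induction using (⊂-wellFounded; Acc; acc)
open import Data.Fin.Subset.Properties
  using (_∈?_; _⊆?_; nonempty?; x∈p∪q⁻; x∈p∩q⁻; x∈p∩q⁺; p∩q⊆p; p∩q⊆q; x∈p∧x∉q⇒x∈p─q; p─q⊆p;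
         p─⊥≡p; ⊆-antisym; x∈⁅x⁆; x∈⁅y⁆⇒x≡y; x∈p⇒p-x⊂p; x∈p∧x≢y⇒x∈p-y; p⊆p∪q; q⊆p∪q; ∪-comm;
         ∪-assoc; ∪-idem; ∪-distribˡ-∩; ∩-comm)
open import Data.Integer.Base as ℤ using (ℤ; +_; -[1+_]; _⊖_; 0ℤ; 1ℤ)
import Data.Integer.Properties as ℤ
open import Data.List.Base using (List; []; _∷_; _++_; map; mapMaybe; foldr)
open import Data.List.Properties using (map-∘)
open import Data.Maybe.Base as Maybe using (Maybe; just; nothing; maybe)
open import Data.Nat.Base as ℕ using (ℕ; zero; suc) renaming (_≤_ to _≤ℕ_)
import Data.Nat.Properties as ℕ
open import Data.Product.Base using (∃-syntax; Σ-syntax; _×_; _,_; proj₁; proj₂)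
open import Data.Sum.Base as Sum using (_⊎_; inj₁; inj₂; [_,_]′)
open import Data.Vec.Base using ([]; _∷_; here; there)
open import Data.Vec.Properties using (≡-dec; ∷-injectiveʳ)
open import Function.Base using (_∘_)
open import Function.Bundles using (_⇔_; mk⇔)
open import Level using (0ℓ)
open import Relation.Binary.Bundles using (Poset)
open import Relation.Binary.Definitions using (DecidableEquality; WeaklyDecidable)
open import Relation.Binary.PropositionalEquality as ≡ using (_≡_; _≢_)
import Relation.Binary.Reasoning.Setoid as SetoidReasoning
open import Relation.Binary.Structures using (IsDecTotalOrder)
open import Relation.Nullary.Decidable
  using (Dec; yes; no; does; dec-true; dec-false; dec⇒maybe; recompute)
open import Relation.Nullary.Negation using (¬_; contradiction)
open import Relation.Unary using (Pred)

-- Integer coefficients for the ring solver.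

-- Real numbers as ring-solver coefficients would not cancel: their equality does not compute.
module IntegerCoefficients {c ℓ} (R : CommutativeRing c ℓ) where
  open CommutativeRing R
  open RingProperties ring
  open Mult semiring renaming (_×_ to _·_)
  open SetoidReasoning setoid

  fromℤ : ℤ → Carrier
  fromℤ (+ n)    = n · 1#
  fromℤ -[1+ n ] = - (suc n · 1#)

  fromℤ-neg : ∀ i → fromℤ (ℤ.- i) ≈ - fromℤ i
  fromℤ-neg (+ zero)  = sym -0#≈0#
  fromℤ-neg (+ suc n) = refl
  fromℤ-neg -[1+ n ]  = sym (-‿involutive _)

  -- Integers of opposite sign are added through `_⊖_`, so the mixed cases of `fromℤ-+` reduce to
  -- this one.
  fromℤ-⊖ : ∀ m n → fromℤ (m ⊖ n) ≈ m · 1# - n · 1#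
  fromℤ-⊖ m       zero    = begin
    m · 1#       ≈⟨ +-identityʳ _ ⟨
    m · 1# + 0#  ≈⟨ +-congˡ -0#≈0# ⟨
    m · 1# - 0#  ∎
  fromℤ-⊖ zero    (suc n) = sym (+-identityˡ _)
  fromℤ-⊖ (suc m) (suc n) = begin
    fromℤ (suc m ⊖ suc n)               ≡⟨ ≡.cong fromℤ (ℤ.[1+m]⊖[1+n]≡m⊖n m n) ⟩
    fromℤ (m ⊖ n)                       ≈⟨ fromℤ-⊖ m n ⟩
    m · 1# - n · 1#                     ≈⟨ +-congʳ (+-identityˡ _) ⟨
    0# + m · 1# - n · 1#                ≈⟨ +-congʳ (+-congʳ (-‿inverseʳ 1#)) ⟨
    1# - 1# + m · 1# - n · 1#           ≈⟨ +-congʳ (+-assoc _ _ _) ⟩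
    1# + (- 1# + m · 1#) - n · 1#       ≈⟨ +-congʳ (+-congˡ (+-comm _ _)) ⟩
    1# + (m · 1# - 1#) - n · 1#         ≈⟨ +-congʳ (+-assoc _ _ _) ⟨
    suc m · 1# - 1# - n · 1#            ≈⟨ +-assoc _ _ _ ⟩
    suc m · 1# + (- 1# - n · 1#)        ≈⟨ +-congˡ (-‿+-comm _ _) ⟩
    suc m · 1# - suc n · 1#             ∎

  fromℤ-+ : ∀ i j → fromℤ (i ℤ.+ j) ≈ fromℤ i + fromℤ j
  fromℤ-+ (+ m)    (+ n)    = ×-homo-+ 1# m n
  fromℤ-+ (+ m)    -[1+ n ] = fromℤ-⊖ m (suc n)
  fromℤ-+ -[1+ m ] (+ n)    = trans (fromℤ-⊖ n (suc m)) (+-comm _ _)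
  fromℤ-+ -[1+ m ] -[1+ n ] = begin
    - (suc (suc (m ℕ.+ n)) · 1#)       ≡⟨ ≡.cong (λ k → - (suc k · 1#)) (ℕ.+-suc m n) ⟨
    - ((suc m ℕ.+ suc n) · 1#)         ≈⟨ -‿cong (×-homo-+ 1# (suc m) (suc n)) ⟩
    - (suc m · 1# + suc n · 1#)        ≈⟨ -‿+-comm _ _ ⟨
    - (suc m · 1#) - suc n · 1#        ∎

  fromℤ-pos*pos : ∀ m n → fromℤ (+ m ℤ.* + n) ≈ fromℤ (+ m) * fromℤ (+ n)
  fromℤ-pos*pos m n = begin
    fromℤ (+ m ℤ.* + n)  ≡⟨ ≡.cong fromℤ (ℤ.pos-* m n) ⟨
    (m ℕ.* n) · 1#       ≈⟨ ×1-homo-* m n ⟩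
    m · 1# * n · 1#      ∎

  fromℤ-pos* : ∀ m j → fromℤ (+ m ℤ.* j) ≈ fromℤ (+ m) * fromℤ j
  fromℤ-pos* m (+ n)    = fromℤ-pos*pos m n
  fromℤ-pos* m -[1+ n ] = begin
    fromℤ (+ m ℤ.* -[1+ n ])        ≡⟨ ≡.cong fromℤ (ℤ.neg-distribʳ-* (+ m) (+ suc n)) ⟨
    fromℤ (ℤ.- (+ m ℤ.* + suc n))   ≈⟨ fromℤ-neg (+ m ℤ.* + suc n) ⟩
    - fromℤ (+ m ℤ.* + suc n)       ≈⟨ -‿cong (fromℤ-pos*pos m (suc n)) ⟩
    - (m · 1# * suc n · 1#)         ≈⟨ -‿distribʳ-* _ _ ⟩
    m · 1# * - (suc n · 1#)         ∎

  fromℤ-* : ∀ i j → fromℤ (i ℤ.* j) ≈ fromℤ i * fromℤ j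
  fromℤ-* (+ m)    j = fromℤ-pos* m j
  fromℤ-* -[1+ m ] j = begin
    fromℤ (-[1+ m ] ℤ.* j)          ≡⟨ ≡.cong fromℤ (ℤ.neg-distribˡ-* (+ suc m) j) ⟨
    fromℤ (ℤ.- (+ suc m ℤ.* j))     ≈⟨ fromℤ-neg (+ suc m ℤ.* j) ⟩
    - fromℤ (+ suc m ℤ.* j)         ≈⟨ -‿cong (fromℤ-pos* (suc m) j) ⟩
    - (suc m · 1# * fromℤ j)        ≈⟨ -‿distribˡ-* _ _ ⟩
    - (suc m · 1#) * fromℤ j        ∎

  morphism : ℤ.+-*-rawRing -Raw-AlmostCommutative⟶ fromCommutativeRing R
  morphism = record
    { ⟦_⟧    = fromℤ
    ; +-homo = fromℤ-+
    ; *-homo = fromℤ-*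
    ; -‿homo = fromℤ-neg
    ; 0-homo = refl
    ; 1-homo = +-identityʳ 1#
    }

  fromℤ-≟ : WeaklyDecidable (Induced-equivalence morphism)
  fromℤ-≟ i j = Maybe.map (λ i≡j → reflexive (≡.cong fromℤ i≡j)) (dec⇒maybe (i ℤ.≟ j))

  module Solver = RingSolver ℤ.+-*-rawRing (fromCommutativeRing R) morphism fromℤ-≟

-- Elements of `𝒫 N` and their enumeration.

module _ {n : ℕ} where

  𝒫-≡ : {N : Subset n} {A B : 𝒫 N} → set A ≡ set B → A ≡ B
  𝒫-≡ ≡.refl = ≡.refl

  _≟ₛ_ : DecidableEquality (Subset n)
  _≟ₛ_ = ≡-dec Bool._≟_

  -- The inclusion stored in an element of `𝒫 N` is irrelevant; since `_⊆?_` decides it, it can be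
  -- recomputed for relevant use.
  set⊆-relevant : {N : Subset n} (A : 𝒫 N) → set A ⊆ N
  set⊆-relevant {N} (A ⟨ A⊆N ⟩) = recompute (A ⊆? N) A⊆N

  -- The function is local to the definition of powerset; only unification can name it.
  powerset-mapMaybe : (N : Subset n) → ∃[ f ] powerset N ≡ mapMaybe f (subsets n)
  powerset-mapMaybe N = _ , ≡.refl

  asElement : (N : Subset n) → Subset n → Maybe (𝒫 N)
  asElement N = proj₁ (powerset-mapMaybe N)

  asElement-set : {N : Subset n} (A : 𝒫 N) → asElement N (set A) ≡ just A
  asElement-set {N} A with set A ⊆? N
  ... | yes _   = ≡.refl
  ... | no  A⊈N = contradiction (λ {i} → set⊆-relevant A {i}) A⊈N

  set-asElement : {N : Subset n} {A : 𝒫 N} (S : Subset n) →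
                  asElement N S ≡ just A → set A ≡ S
  set-asElement {N} S eq with S ⊆? N
  set-asElement {N} S ≡.refl | yes _ = ≡.refl
  set-asElement {N} S ()     | no  _

-- Order, squares and inverses in the real field.

module OrderedField (ℝ : RealNumbers) where
  open RealNumbers ℝ
  open IntegerCoefficients commutativeRing using (module Solver)
  open Solver using (solve; _:=_; _:+_; _:*_; _:-_; :-_; con)
  open IsDecTotalOrder isDecTotalOrder public
    using (≤-respʳ-≈; ≤-respˡ-≈; antisym; total; _≟_)
    renaming (refl to ≤-refl; trans to ≤-trans; reflexive to ≤-reflexive)
  open SetoidReasoning setoid

  0≤-resp : ∀ {x y} → x ≈ y → 0# ≤ x → 0# ≤ y
  0≤-resp = ≤-respʳ-≈

  0≤b-a⇒a≤b : ∀ {a b} → 0# ≤ b - a → a ≤ b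
  0≤b-a⇒a≤b {a} {b} 0≤b-a =
    ≤-respˡ-≈ (+-identityˡ a)
      (≤-respʳ-≈ (solve 2 (λ a b → b :- a :+ a := b) refl a b)
        (+-monoˡ-≤ a 0≤b-a))

  a≤b⇒0≤b-a : ∀ {a b} → a ≤ b → 0# ≤ b - a
  a≤b⇒0≤b-a {a} {b} a≤b = ≤-respˡ-≈ (-‿inverseʳ a) (+-monoˡ-≤ (- a) a≤b)

  +-mono-≤ : ∀ {a b c d} → a ≤ b → c ≤ d → a + c ≤ b + d
  +-mono-≤ {a} {b} {c} {d} a≤b c≤d =
    ≤-trans (+-monoˡ-≤ c a≤b)
      (≤-respˡ-≈ (+-comm c b) (≤-respʳ-≈ (+-comm d b) (+-monoˡ-≤ b c≤d)))

  +-nonneg : ∀ {a b} → 0# ≤ a → 0# ≤ b → 0# ≤ a + b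
  +-nonneg 0≤a 0≤b = ≤-respˡ-≈ (+-identityˡ 0#) (+-mono-≤ 0≤a 0≤b)

  ±-nonneg⇒≈0 : ∀ {a} → 0# ≤ a → 0# ≤ - a → a ≈ 0#
  ±-nonneg⇒≈0 {a} 0≤a 0≤-a =
    antisym (0≤b-a⇒a≤b (0≤-resp (sym (+-identityˡ (- a))) 0≤-a)) 0≤a

  square-nonneg : ∀ a → 0# ≤ a * a
  square-nonneg a with total 0# a
  ... | inj₁ 0≤a = *-nonneg 0≤a 0≤a
  ... | inj₂ a≤0 = 0≤-resp (solve 1 (λ a → (con 0ℤ :- a) :* (con 0ℤ :- a) := a :* a) refl a)
                     (*-nonneg 0≤-a 0≤-a)
    where
    0≤-a = a≤b⇒0≤b-a a≤0

  0≤1 : 0# ≤ 1#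
  0≤1 = 0≤-resp (*-identityʳ 1#) (square-nonneg 1#)

  -- From a * b = 1 follows b = a * (b * b), a product of nonnegative factors.
  inverse-nonneg : ∀ {a b} → 0# ≤ a → a * b ≈ 1# → 0# ≤ b
  inverse-nonneg {a} {b} 0≤a ab≈1 =
    0≤-resp (begin
      a * (b * b) ≈⟨ *-assoc a b b ⟨
      a * b * b   ≈⟨ *-congʳ ab≈1 ⟩
      1# * b      ≈⟨ *-identityˡ b ⟩
      b           ∎) (*-nonneg 0≤a (square-nonneg b))

  -- Such ratios, one for each pair of sets, are summed in `∈smallestFace⇒≼` to obtain the constant
  -- of `_≼_`.
  ∃-ratio : ∀ {a b} → 0# ≤ a → 0# ≤ b → (a ≈ 0# → b ≈ 0#) → ∃[ q ] 0# ≤ q × b ≤ q * a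
  ∃-ratio {a} {b} 0≤a 0≤b a≈0⇒b≈0 with a ≟ 0#
  -- If a is zero, then so is b, and the default q = 0 does.
  ... | yes a≈0 = 0# , ≤-refl , ≤-reflexive (trans (a≈0⇒b≈0 a≈0) (sym (zeroˡ a)))
  ... | no  a≉0 with inverse a a≉0
  ...   | y , ay≈1 = b * y , *-nonneg 0≤b (inverse-nonneg 0≤a ay≈1) , ≤-reflexive (begin
    b            ≈⟨ *-identityʳ b ⟨
    b * 1#       ≈⟨ *-congˡ ay≈1 ⟨
    b * (a * y)  ≈⟨ solve 3 (λ a b y → b :* (a :* y) := b :* y :* a) refl a b y ⟩
    b * y * a    ∎)

-- Finite sums over lists, subsets and power sets.

module FiniteSums (ℝ : RealNumbers) where
  open RealNumbers ℝ
  open OrderedField ℝ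
  open IntegerCoefficients commutativeRing using (module Solver)
  open Solver using (solve; _:=_; _:+_; _:*_)
  open SetoidReasoning setoid

  module _ {A : Set} where

    ∑ : List A → (A → Carrier) → Carrier
    ∑ xs f = foldr _+_ 0# (map f xs)

    ∑-cong : ∀ xs {f g} → (∀ x → f x ≈ g x) → ∑ xs f ≈ ∑ xs g
    ∑-cong []       f≈g = refl
    ∑-cong (x ∷ xs) f≈g = +-cong (f≈g x) (∑-cong xs f≈g)

    ∑-mono : ∀ xs {f g} → (∀ x → f x ≤ g x) → ∑ xs f ≤ ∑ xs g
    ∑-mono []       f≤g = ≤-refl
    ∑-mono (x ∷ xs) f≤g = +-mono-≤ (f≤g x) (∑-mono xs f≤g)

    ∑-zero : ∀ xs {f} → (∀ x → f x ≈ 0#) → ∑ xs f ≈ 0#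
    ∑-zero []       f≈0 = refl
    ∑-zero (x ∷ xs) f≈0 = trans (+-cong (f≈0 x) (∑-zero xs f≈0)) (+-identityˡ 0#)

    ∑-nonneg : ∀ xs {f} → (∀ x → 0# ≤ f x) → 0# ≤ ∑ xs f
    ∑-nonneg []       0≤f = ≤-refl
    ∑-nonneg (x ∷ xs) 0≤f = +-nonneg (0≤f x) (∑-nonneg xs 0≤f)

    ∑-linear : ∀ xs a f b g → ∑ xs (λ x → a * f x + b * g x) ≈ a * ∑ xs f + b * ∑ xs g
    ∑-linear []       a f b g = sym (trans (+-cong (zeroʳ a) (zeroʳ b)) (+-identityˡ 0#))
    ∑-linear (x ∷ xs) a f b g = begin
      a * f x + b * g x + ∑ xs (λ x → a * f x + b * g x)  ≈⟨ +-congˡ (∑-linear xs a f b g) ⟩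
      a * f x + b * g x + (a * ∑ xs f + b * ∑ xs g)       ≈⟨ solve 6 (λ a f b g F G →
        a :* f :+ b :* g :+ (a :* F :+ b :* G) := a :* (f :+ F) :+ b :* (g :+ G))
        refl a (f x) b (g x) (∑ xs f) (∑ xs g) ⟩
      a * (f x + ∑ xs f) + b * (g x + ∑ xs g)             ∎

    ∑-++ : ∀ xs ys f → ∑ (xs ++ ys) f ≈ ∑ xs f + ∑ ys f
    ∑-++ []       ys f = sym (+-identityˡ _)
    ∑-++ (x ∷ xs) ys f = trans (+-congˡ (∑-++ xs ys f)) (sym (+-assoc _ _ _))

    ∑-mapMaybe : ∀ {B : Set} (g : B → Maybe A) xs f →
                 ∑ (mapMaybe g xs) f ≈ foldr _+_ 0# (map (λ x → maybe f 0# (g x)) xs)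
    ∑-mapMaybe g []       f = refl
    ∑-mapMaybe g (x ∷ xs) f with g x
    ... | just _  = +-congˡ (∑-mapMaybe g xs f)
    ... | nothing = trans (∑-mapMaybe g xs f) (sym (+-identityˡ _))

  ∑-map : ∀ {A B : Set} (g : B → A) xs f → ∑ (map g xs) f ≡ ∑ xs (f ∘ g)
  ∑-map g xs f = ≡.cong (foldr _+_ 0#) (≡.sym (map-∘ xs))

  -- `subsets` lists the sets without the first element before those with it. The half that misses
  -- `s ∷ A` sums to zero; the other half is the same claim for `A`.
  ∑-subsets-single : ∀ {n} (A : Subset n) {f : Subset n → Carrier} →
                     (∀ S → S ≢ A → f S ≈ 0#) → ∑ (subsets n) f ≈ f A
  ∑-subsets-single []            f≈0 = +-identityʳ _
  ∑-subsets-single {suc n} (s ∷ A) {f} f≈0 = begin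
    ∑ (map (outside ∷_) (subsets n) ++ map (inside ∷_) (subsets n)) f
      ≈⟨ ∑-++ (map (outside ∷_) (subsets n)) _ f ⟩
    ∑ (map (outside ∷_) (subsets n)) f + ∑ (map (inside ∷_) (subsets n)) f
      ≡⟨ ≡.cong₂ _+_ (∑-map (outside ∷_) (subsets n) f) (∑-map (inside ∷_) (subsets n) f) ⟩
    ∑ (subsets n) (f ∘ (outside ∷_)) + ∑ (subsets n) (f ∘ (inside ∷_))  ≈⟨ halves s f≈0 ⟩
    f (s ∷ A)  ∎
    where
    halves : ∀ s → (∀ S → S ≢ s ∷ A → f S ≈ 0#) →
             ∑ (subsets n) (f ∘ (outside ∷_)) + ∑ (subsets n) (f ∘ (inside ∷_)) ≈ f (s ∷ A)
    halves outside f≈0 = trans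
      (+-cong (∑-subsets-single A λ S S≢A → f≈0 (outside ∷ S) (S≢A ∘ ∷-injectiveʳ))
              (∑-zero (subsets n) λ S → f≈0 (inside ∷ S) λ ()))
      (+-identityʳ _)
    halves inside  f≈0 = trans
      (+-cong (∑-zero (subsets n) λ S → f≈0 (outside ∷ S) λ ())
              (∑-subsets-single A λ S S≢A → f≈0 (inside ∷ S) (S≢A ∘ ∷-injectiveʳ)))
      (+-identityˡ _)

  module _ {n : ℕ} {N : Subset n} where

    -- The coordinate vector at `A`. Underlying sets are compared because they determine the
    -- elements of `𝒫 N`.
    δ : 𝒫 N → 𝒫 N → Carrier
    δ A B = if does (set A ≟ₛ set B) then 1# else 0#

    -- The sum is rewritten over `subsets n`, where sets not included in `N` contribute 0; there
    -- `set A` is the only index left.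
    ∑-δ : ∀ (f : 𝒫 N → Carrier) A → ∑ (powerset N) (λ B → f B * δ A B) ≈ f A
    ∑-δ f A = begin
      ∑ (powerset N) g                                 ≈⟨ ∑-mapMaybe (asElement N) (subsets n) g ⟩
      ∑ (subsets n) (λ S → maybe g 0# (asElement N S)) ≈⟨ ∑-subsets-single (set A) off-A ⟩
      maybe g 0# (asElement N (set A))                 ≡⟨ ≡.cong (maybe g 0#) (asElement-set A) ⟩
      f A * δ A A
        ≡⟨ ≡.cong (λ b → f A * (if b then 1# else 0#)) (dec-true (set A ≟ₛ set A) ≡.refl) ⟩
      f A * 1#                                         ≈⟨ *-identityʳ _ ⟩
      f A                                              ∎
      where
      g : 𝒫 N → Carrier
      g B = f B * δ A B

      off-A : ∀ S → S ≢ set A → maybe g 0# (asElement N S) ≈ 0#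
      off-A S S≢A with asElement N S in eq
      ... | nothing = refl
      ... | just B  = begin
        f B * δ A B
          ≡⟨ ≡.cong (λ b → f B * (if b then 1# else 0#)) (dec-false (set A ≟ₛ set B)
               λ A≡B → S≢A (≡.sym (≡.trans A≡B (set-asElement S eq)))) ⟩
        f B * 0#     ≈⟨ zeroʳ _ ⟩
        0#           ∎

    -- By `∑-δ` a single term is itself a sum over the whole power set, so the claim reduces to
    -- monotonicity of sums.
    term≤∑ : ∀ {f : 𝒫 N → Carrier} → (∀ A → 0# ≤ f A) → ∀ A → f A ≤ ∑ (powerset N) f
    term≤∑ {f} 0≤f A = ≤-respˡ-≈ (∑-δ f A) (∑-mono (powerset N) f*δ≤f)
      where
      f*δ≤f : ∀ B → f B * δ A B ≤ f B
      f*δ≤f B with does (set A ≟ₛ set B)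
      ... | true  = ≤-reflexive (*-identityʳ _)
      ... | false = ≤-respˡ-≈ (sym (zeroʳ _)) (0≤f B)

    ∑≈0⇒term≈0 : ∀ {f : 𝒫 N → Carrier} → (∀ A → 0# ≤ f A) → ∑ (powerset N) f ≈ 0# → ∀ A → f A ≈ 0#
    ∑≈0⇒term≈0 0≤f ∑f≈0 A = antisym (≤-respʳ-≈ ∑f≈0 (term≤∑ 0≤f A)) (0≤f A)

-- The cone of supermodular functions and its faces.

module Cone (ℝ : RealNumbers) where
  open RealNumbers ℝ
  open OrderedField ℝ
  open FiniteSums ℝ
  open SetFunctions ℝ
  open IntegerCoefficients commutativeRing using (module Solver)
  open Solver using (solve; _:=_; _:+_; _:*_; _:-_; :-_; con)
  open SetoidReasoning setoid

  module _ {n : ℕ} {N : Subset n} where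

    D : ℝ^𝒫 N → 𝒫 N → 𝒫 N → Carrier
    D m A B = m (A ∪ₚ B) + m (A ∩ₚ B) - (m A + m B)

    D-cong : ∀ {m m'} → (∀ A → m A ≈ m' A) → ∀ A B → D m A B ≈ D m' A B
    D-cong m≈m' A B = +-cong (+-cong (m≈m' _) (m≈m' _)) (-‿cong (+-cong (m≈m' A) (m≈m' B)))

    D-zero : ∀ A B → D (λ _ → 0#) A B ≈ 0#
    D-zero A B = -‿inverseʳ _

    D-neg : ∀ m A B → D (λ A → - m A) A B ≈ - D m A B
    D-neg m A B = solve 4 (λ p q r s → :- p :+ :- q :- (:- r :+ :- s) := :- (p :+ q :- (r :+ s)))
      refl (m (A ∪ₚ B)) (m (A ∩ₚ B)) (m A) (m B)

    -- The form of linearity on which the argument runs: general c serves `_≼_`, and c = 1 serves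
    -- plain differences.
    D-scale-minus : ∀ c m m' A B → D (λ A → c * m A - m' A) A B ≈ c * D m A B - D m' A B
    D-scale-minus c m m' A B = solve 9 (λ c p q r s p' q' r' s' →
        (c :* p :- p') :+ (c :* q :- q') :- ((c :* r :- r') :+ (c :* s :- s'))
        := c :* (p :+ q :- (r :+ s)) :- (p' :+ q' :- (r' :+ s')))
      refl c (m (A ∪ₚ B)) (m (A ∩ₚ B)) (m A) (m B) (m' (A ∪ₚ B)) (m' (A ∩ₚ B)) (m' A) (m' B)

    supermodular⇒D-nonneg : ∀ {m} → Supermodular N m → ∀ A B → 0# ≤ D m A B
    supermodular⇒D-nonneg Km A B = a≤b⇒0≤b-a (Km A B)

    D-nonneg⇒supermodular : ∀ {m} → (∀ A B → 0# ≤ D m A B) → Supermodular N m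
    D-nonneg⇒supermodular 0≤D A B = 0≤b-a⇒a≤b (0≤D A B)

    -- Supermodularity is a condition on `D m` alone, so it passes between functions that differ by
    -- a modular one.
    supermodular-transfer : ∀ {m m'} → (∀ A B → D m A B ≈ D m' A B) →
                            Supermodular N m → Supermodular N m'
    supermodular-transfer D≈D' Km = D-nonneg⇒supermodular λ A B →
      0≤-resp (D≈D' A B) (supermodular⇒D-nonneg Km A B)

    supermodular-cong : ∀ {m m'} → (∀ A → m A ≈ m' A) → Supermodular N m → Supermodular N m'
    supermodular-cong m≈m' = supermodular-transfer (D-cong m≈m')

    supermodular-zero : Supermodular N (λ _ → 0#)
    supermodular-zero A B = ≤-refl

    supermodular-+ : ∀ {m m'} → Supermodular N m → Supermodular N m' →
                     Supermodular N (λ A → m A + m' A)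
    supermodular-+ {m} {m'} Km Km' A B =
      ≤-respˡ-≈ (interchange (m A) (m B) (m' A) (m' B))
        (≤-respʳ-≈ (interchange (m (A ∪ₚ B)) (m (A ∩ₚ B)) (m' (A ∪ₚ B)) (m' (A ∩ₚ B)))
          (+-mono-≤ (Km A B) (Km' A B)))
      where
      interchange : ∀ p q r s → p + q + (r + s) ≈ p + r + (q + s)
      interchange = solve 4 (λ p q r s → p :+ q :+ (r :+ s) := p :+ r :+ (q :+ s)) refl

    -- Scalar products and the functionals they represent.

    ⟪⟫-linear : ∀ a m b m' v → ⟪ (λ A → a * m A + b * m' A) , v ⟫ ≈ a * ⟪ m , v ⟫ + b * ⟪ m' , v ⟫
    ⟪⟫-linear a m b m' v = trans
      (∑-cong (powerset N) λ A →
        solve 5 (λ a m b m' v → (a :* m :+ b :* m') :* v := a :* (m :* v) :+ b :* (m' :* v))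
          refl a (m A) b (m' A) (v A))
      (∑-linear (powerset N) a (λ A → m A * v A) b (λ A → m' A * v A))

    ⟪⟫-congˡ : ∀ {m m'} v → (∀ A → m A ≈ m' A) → ⟪ m , v ⟫ ≈ ⟪ m' , v ⟫
    ⟪⟫-congˡ v m≈m' = ∑-cong (powerset N) λ A → *-congʳ (m≈m' A)

    ⟪⟫-+ : ∀ m m' v → ⟪ (λ A → m A + m' A) , v ⟫ ≈ ⟪ m , v ⟫ + ⟪ m' , v ⟫
    ⟪⟫-+ m m' v = begin
      ⟪ (λ A → m A + m' A) , v ⟫
        ≈⟨ ⟪⟫-congˡ v (λ A → +-cong (*-identityˡ (m A)) (*-identityˡ (m' A))) ⟨
      ⟪ (λ A → 1# * m A + 1# * m' A) , v ⟫     ≈⟨ ⟪⟫-linear 1# m 1# m' v ⟩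
      1# * ⟪ m , v ⟫ + 1# * ⟪ m' , v ⟫         ≈⟨ +-cong (*-identityˡ _) (*-identityˡ _) ⟩
      ⟪ m , v ⟫ + ⟪ m' , v ⟫                   ∎

    ⟪⟫-zeroˡ : ∀ v → ⟪ (λ _ → 0#) , v ⟫ ≈ 0#
    ⟪⟫-zeroˡ v = ∑-zero (powerset N) λ A → zeroˡ (v A)

    ⟪⟫-scale-minus : ∀ c m m' v → ⟪ (λ A → c * m A - m' A) , v ⟫ ≈ c * ⟪ m , v ⟫ - ⟪ m' , v ⟫
    ⟪⟫-scale-minus c m m' v = begin
      ⟪ (λ A → c * m A - m' A) , v ⟫            ≈⟨ ⟪⟫-congˡ v (λ A → +-congˡ (-1*x≈-x (m' A))) ⟨
      ⟪ (λ A → c * m A + - 1# * m' A) , v ⟫     ≈⟨ ⟪⟫-linear c m (- 1#) m' v ⟩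
      c * ⟪ m , v ⟫ + - 1# * ⟪ m' , v ⟫         ≈⟨ +-congˡ (-1*x≈-x _) ⟩
      c * ⟪ m , v ⟫ - ⟪ m' , v ⟫                ∎
      where open RingProperties ring using (-1*x≈-x)

    -- A face has to be given by a vector. With this predicate a functional is assembled from
    -- evaluations by linear operations, and its vector is built alongside.
    Representable : (ℝ^𝒫 N → Carrier) → Set
    Representable φ = ∃[ v ] ∀ m → φ m ≈ ⟪ m , v ⟫

    representable-eval : ∀ A → Representable (λ m → m A)
    representable-eval A = δ A , λ m → sym (∑-δ m A)

    representable-linear : ∀ {φ ψ} a b → Representable φ → Representable ψ →
                           Representable (λ m → a * φ m + b * ψ m)
    representable-linear {φ} {ψ} a b (v , φ≈v) (w , ψ≈w) = (λ A → a * v A + b * w A) , λ m → begin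
      a * φ m + b * ψ m                       ≈⟨ +-cong (*-congˡ (φ≈v m)) (*-congˡ (ψ≈w m)) ⟩
      a * ⟪ m , v ⟫ + b * ⟪ m , w ⟫
        ≈⟨ ∑-linear (powerset N) a (λ A → m A * v A) b (λ A → m A * w A) ⟨
      ∑ (powerset N) (λ A → a * (m A * v A) + b * (m A * w A))
        ≈⟨ ∑-cong (powerset N) (λ A → solve 5 (λ a m v b w →
               a :* (m :* v) :+ b :* (m :* w) := m :* (a :* v :+ b :* w))
             refl a (m A) (v A) b (w A)) ⟩
      ⟪ m , (λ A → a * v A + b * w A) ⟫       ∎

    representable-cong : ∀ {φ ψ} → (∀ m → φ m ≈ ψ m) → Representable φ → Representable ψ
    representable-cong φ≈ψ (v , φ≈v) = v , λ m → trans (sym (φ≈ψ m)) (φ≈v m)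

    representable-+ : ∀ {φ ψ} → Representable φ → Representable ψ → Representable (λ m → φ m + ψ m)
    representable-+ Rφ Rψ = representable-cong (λ m → +-cong (*-identityˡ _) (*-identityˡ _))
      (representable-linear 1# 1# Rφ Rψ)

    representable-scale : ∀ {φ} a → Representable φ → Representable (λ m → a * φ m)
    representable-scale a Rφ = representable-cong (λ m → trans (+-congˡ (zeroˡ _)) (+-identityʳ _))
      (representable-linear a 0# Rφ Rφ)

    representable-∑ : ∀ {A : Set} (xs : List A) {φ : A → ℝ^𝒫 N → Carrier} →
                      (∀ x → Representable (φ x)) → Representable (λ m → ∑ xs (λ x → φ x m))
    representable-∑ []       Rφ = (λ _ → 0#) , λ m → sym (∑-zero (powerset N) λ A → zeroʳ (m A))
    representable-∑ (x ∷ xs) Rφ = representable-+ (Rφ x) (representable-∑ xs Rφ)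

    representable-D : ∀ A B → Representable (λ m → D m A B)
    representable-D A B = representable-cong
      (λ m → solve 4 (λ p q r s → con 1ℤ :* (p :+ q) :+ (con 0ℤ :- con 1ℤ) :* (r :+ s) := p :+ q :- (r :+ s))
        refl (m (A ∪ₚ B)) (m (A ∩ₚ B)) (m A) (m B))
      -- Both coefficients are inferred from the equation above, where the solver reads them as 1
      -- and 0 - 1.
      (representable-linear _ _
        (representable-+ (representable-eval (A ∪ₚ B)) (representable-eval (A ∩ₚ B)))
        (representable-+ (representable-eval A) (representable-eval B)))

    -- Faces as down-sets of a preorder.

    K : Pred (ℝ^𝒫 N) 0ℓ
    K = Supermodular N

    -- The preorder whose down-sets in 𝒦(N) are the smallest faces.
    infix 4 _≼_
    _≼_ : ℝ^𝒫 N → ℝ^𝒫 N → Set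
    m' ≼ m = ∃[ c ] K (λ A → c * m A - m' A)

    -- Together with `K m` this says that m is modular, that is, that m lies in the least face.
    NegSupermodular : Pred (ℝ^𝒫 N) 0ℓ
    NegSupermodular m = K (λ A → - m A)

    ≼-zero⇒negSupermodular : ∀ {m} → m ≼ (λ _ → 0#) → NegSupermodular m
    ≼-zero⇒negSupermodular (c , K-m) =
      supermodular-cong (λ A → trans (+-congʳ (zeroʳ c)) (+-identityˡ _)) K-m

    negSupermodular⇒≼ : ∀ {m} m' → NegSupermodular m → m ≼ m'
    negSupermodular⇒≼ m' K-m = 0# ,
      supermodular-cong (λ A → sym (trans (+-congʳ (zeroˡ _)) (+-identityˡ _))) K-m

    open NonemptyFace using (members; v; k; bound; nonempty)

    -- The zero function is in the cone, so k is at most 0. A member m attains k, and m + m is in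
    -- the cone, so k is at most k + k.
    face-k≈0 : (G : NonemptyFace K) → k G ≈ 0#
    face-k≈0 G with nonempty G
    ... | m , Km , k≈mv = antisym
      (≤-respʳ-≈ (⟪⟫-zeroˡ (v G)) (bound G supermodular-zero))
      (≤-respʳ-≈ k+k-k≈k (a≤b⇒0≤b-a k≤k+k))
      where
      k≤k+k : k G ≤ k G + k G
      k≤k+k = ≤-respʳ-≈ (trans (⟪⟫-+ m m (v G)) (sym (+-cong k≈mv k≈mv)))
        (bound G (supermodular-+ Km Km))
      k+k-k≈k : k G + k G - k G ≈ k G
      k+k-k≈k = solve 1 (λ k → k :+ k :- k := k) refl (k G)

    -- The functional of the face is nonnegative at m' and at c * m - m' and vanishes at m, so it
    -- vanishes at m'.
    face-down-closed : (G : NonemptyFace K) → ∀ m m' → members G m → K m' → m' ≼ m → members G m'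
    face-down-closed G m m' (_ , k≈mv) Km' (c , Kcm-m') = Km' , trans (face-k≈0 G) (sym m'v≈0)
      where
      k≈0 = face-k≈0 G
      -m'v : c * ⟪ m , v G ⟫ - ⟪ m' , v G ⟫ ≈ - ⟪ m' , v G ⟫
      -m'v = trans (+-congʳ (trans (*-congˡ (trans (sym k≈mv) k≈0)) (zeroʳ c))) (+-identityˡ _)
      m'v≈0 : ⟪ m' , v G ⟫ ≈ 0#
      m'v≈0 = ±-nonneg⇒≈0
        (≤-respˡ-≈ k≈0 (bound G Km'))
        (≤-respˡ-≈ k≈0 (≤-respʳ-≈ (trans (⟪⟫-scale-minus c m m' (v G)) -m'v) (bound G Kcm-m')))

    zero∈face : (G : NonemptyFace K) → members G (λ _ → 0#)
    zero∈face G = supermodular-zero , trans (face-k≈0 G) (sym (⟪⟫-zeroˡ (v G)))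

    -- The smallest face containing a given function.

    module _ (m : ℝ^𝒫 N) (Km : K m) where

      private
        -- Marks the tight pairs of m, those on which `D m` vanishes.
        weight : 𝒫 N → 𝒫 N → Carrier
        weight A B with D m A B ≟ 0#
        ... | yes _ = 1#
        ... | no  _ = 0#

        weight-nonneg : ∀ A B → 0# ≤ weight A B
        weight-nonneg A B with D m A B ≟ 0#
        ... | yes _ = 0≤1
        ... | no  _ = ≤-refl

        weight*D≈0 : ∀ A B → weight A B * D m A B ≈ 0#
        weight*D≈0 A B with D m A B ≟ 0#
        ... | yes D≈0 = trans (*-identityˡ _) D≈0
        ... | no  _   = zeroˡ _

        weighted≈0⇒≈0 : ∀ A B → D m A B ≈ 0# → ∀ {y} → weight A B * y ≈ 0# → y ≈ 0#
        weighted≈0⇒≈0 A B D≈0 wy≈0 with D m A B ≟ 0#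
        ... | yes _   = trans (sym (*-identityˡ _)) wy≈0
        ... | no  D≉0 = contradiction D≈0 D≉0

        -- Nonnegative on the cone, and zero at a supermodular m' exactly when `D m'` vanishes on
        -- all tight pairs of m. Its vector exposes the smallest face.
        tightSum : ℝ^𝒫 N → Carrier
        tightSum m' = ∑ (powerset N) λ A → ∑ (powerset N) λ B → weight A B * D m' A B

        tightSum-representable : Representable tightSum
        tightSum-representable = representable-∑ (powerset N) λ A →
          representable-∑ (powerset N) λ B →
            representable-scale (weight A B) (representable-D A B)

        term-nonneg : ∀ {m'} → K m' → ∀ A B → 0# ≤ weight A B * D m' A B
        term-nonneg Km' A B = *-nonneg (weight-nonneg A B) (supermodular⇒D-nonneg Km' A B)

      -- The exposing vector stays opaque; later arguments use only that m is a member and that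
      -- every member is below m.
      abstract
        smallestFace : NonemptyFace K
        smallestFace = record
          { v = v'
          ; k = 0#
          ; bound = λ {m'} Km' → ≤-respʳ-≈ (tight≈v m')
              (∑-nonneg (powerset N) λ A → ∑-nonneg (powerset N) (term-nonneg Km' A))
          ; nonempty = m , Km , m∈
          }
          where
          v' : ℝ^𝒫 N
          v' = proj₁ tightSum-representable
          tight≈v : ∀ m' → tightSum m' ≈ ⟪ m' , v' ⟫
          tight≈v = proj₂ tightSum-representable
          m∈ : 0# ≈ ⟪ m , v' ⟫
          m∈ = trans (sym (∑-zero (powerset N) λ A → ∑-zero (powerset N) (weight*D≈0 A))) (tight≈v m)

        m∈smallestFace : members smallestFace m
        m∈smallestFace = nonempty smallestFace .proj₂

        -- A vanishing sum of nonnegative terms has vanishing terms, so `D m'` is zero wherever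
        -- `D m` is. As there are finitely many pairs, one constant c then bounds `D m'` by c times
        -- `D m`.
        ∈smallestFace⇒≼ : ∀ m' → members smallestFace m' → m' ≼ m
        ∈smallestFace⇒≼ m' (Km' , 0≈m'v) = c , D-nonneg⇒supermodular λ A B →
            0≤-resp (sym (D-scale-minus c m m' A B)) (0≤cD-D' A B)
          where
          tight≈0 : tightSum m' ≈ 0#
          tight≈0 = trans (proj₂ tightSum-representable m') (sym 0≈m'v)

          term≈0 : ∀ A B → weight A B * D m' A B ≈ 0#
          term≈0 A = ∑≈0⇒term≈0 (term-nonneg Km' A)
            (∑≈0⇒term≈0 (λ A → ∑-nonneg (powerset N) (term-nonneg Km' A)) tight≈0 A)

          ratio : ∀ A B → ∃[ q ] 0# ≤ q × D m' A B ≤ q * D m A B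
          ratio A B = ∃-ratio (supermodular⇒D-nonneg Km A B) (supermodular⇒D-nonneg Km' A B)
            λ D≈0 → weighted≈0⇒≈0 A B D≈0 (term≈0 A B)

          q : 𝒫 N → 𝒫 N → Carrier
          q A B = proj₁ (ratio A B)

          q-nonneg : ∀ A B → 0# ≤ q A B
          q-nonneg A B = proj₁ (proj₂ (ratio A B))

          -- The ratios are nonnegative, so their sum bounds each of them and can stand in for their
          -- maximum.
          c : Carrier
          c = ∑ (powerset N) λ A → ∑ (powerset N) (q A)

          q≤c : ∀ A B → q A B ≤ c
          q≤c A B = ≤-trans (term≤∑ (q-nonneg A) B)
            (term≤∑ (λ A → ∑-nonneg (powerset N) (q-nonneg A)) A)

          0≤cD-D' : ∀ A B → 0# ≤ c * D m A B - D m' A B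
          -- The excess splits into (c - q) * D m and q * D m - D m', both nonnegative.
          0≤cD-D' A B = 0≤-resp
            (solve 4 (λ c q d d' → (c :- q) :* d :+ (q :* d :- d') := c :* d :- d') refl
              c (q A B) (D m A B) (D m' A B))
            (+-nonneg (*-nonneg (a≤b⇒0≤b-a (q≤c A B)) (supermodular⇒D-nonneg Km A B))
              (a≤b⇒0≤b-a (proj₂ (proj₂ (ratio A B)))))

      smallestFace-smallest : IsSmallestFaceContaining K m smallestFace
      smallestFace-smallest = m∈smallestFace , λ G m∈G {m'} m'∈F →
        face-down-closed G m m' m∈G (proj₁ m'∈F) (∈smallestFace⇒≼ m' m'∈F)

    -- Extremality expressed by the preorder instead of faces.

    ExtremeCriterion : Pred (ℝ^𝒫 N) 0ℓ
    ExtremeCriterion m = K m × ¬ NegSupermodular m ×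
      (∀ m' → K m' → m' ≼ m → NegSupermodular m' ⊎ m ≼ m')

    private
      zeroFace : NonemptyFace K
      zeroFace = smallestFace (λ _ → 0#) supermodular-zero

      ∈least⇒negSupermodular : ∀ F → IsLeast (facePoset K) F → ∀ m → members F m → NegSupermodular m
      ∈least⇒negSupermodular F least m m∈F =
        ≼-zero⇒negSupermodular {m} (∈smallestFace⇒≼ (λ _ → 0#) supermodular-zero m (least zeroFace {m} m∈F))

      negSupermodular⇒∈ : ∀ G m → K m → NegSupermodular m → members G m
      negSupermodular⇒∈ G m Km K-m =
        face-down-closed G (λ _ → 0#) m (zero∈face G) Km (negSupermodular⇒≼ {m} (λ _ → 0#) K-m)

    -- The atom condition is applied to the smallest face of m'. If that face is least, m' is
    -- modular; if it equals F, it contains m, so m is below m'.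
    extreme⇒criterion : ∀ m → Extreme N m → ExtremeCriterion m
    extreme⇒criterion m (Km , F , (m∈F , F-smallest) , F≢least , F-atom) =
      Km , ¬K-m , below
      where
      ¬K-m : ¬ NegSupermodular m
      ¬K-m K-m = F≢least λ G {m'} → F-smallest G (negSupermodular⇒∈ G m Km K-m) {m'}

      below : ∀ m' → K m' → m' ≼ m → NegSupermodular m' ⊎ m ≼ m'
      below m' Km' m'≼m =
        Sum.map (λ least → ∈least⇒negSupermodular F' (λ G {m''} → least G {m''}) m' (m∈smallestFace m' Km'))
                (λ F'≈F → ∈smallestFace⇒≼ m' Km' m (proj₂ F'≈F {m} m∈F))
                (F-atom F' λ {m''} →
                  proj₂ (smallestFace-smallest m' Km') F (face-down-closed F m m' m∈F Km' m'≼m) {m''})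
        where F' = smallestFace m' Km'

    criterion⇒extreme : ∀ m → ExtremeCriterion m → Extreme N m
    criterion⇒extreme m (Km , ¬K-m , below) =
      Km , F , smallestFace-smallest m Km ,
      (λ least → ¬K-m (∈least⇒negSupermodular F (λ G {m''} → least G {m''}) m (m∈smallestFace m Km))) ,
      atom
      where
      F = smallestFace m Km

      atom : ∀ G → Poset._≤_ (facePoset K) G F →
             IsLeast (facePoset K) G ⊎ Poset._≈_ (facePoset K) G F
      -- If G contains m, it contains the smallest face F. Otherwise no member of G lies above m,
      -- because faces are closed downwards; by the criterion each member is then modular, and G is
      -- least.
      atom G G≤F = byCases (k G ≟ ⟪ m , v G ⟫)
        where
        least : ¬ (k G ≈ ⟪ m , v G ⟫) → IsLeast (facePoset K) G
        least k≉mv H {m'} m'∈G =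
          [ negSupermodular⇒∈ H m' (proj₁ m'∈G)
          , (λ m≼m' → contradiction (proj₂ (face-down-closed G m' m m'∈G Km m≼m')) k≉mv)
          ]′ (below m' (proj₁ m'∈G) (∈smallestFace⇒≼ m Km m' (G≤F {m'} m'∈G)))

        byCases : Dec (k G ≈ ⟪ m , v G ⟫) → IsLeast (facePoset K) G ⊎ Poset._≈_ (facePoset K) G F
        byCases (yes k≈mv) = inj₂ ((λ {m'} → G≤F {m'}) ,
          λ {m'} → proj₂ (smallestFace-smallest m Km) G (Km , k≈mv) {m'})
        byCases (no  k≉mv) = inj₁ λ H {m'} → least k≉mv H {m'}

-- Identities between finite subsets.

module _ {n : ℕ} where

  p⊆q⇒p∩q≡p : {p q : Subset n} → p ⊆ q → p ∩ q ≡ p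
  p⊆q⇒p∩q≡p {p} {q} p⊆q = ⊆-antisym (p∩q⊆p p q) λ i∈p → x∈p∩q⁺ (i∈p , p⊆q i∈p)

  p⊆q⇒p∪q≡q : {p q : Subset n} → p ⊆ q → p ∪ q ≡ q
  p⊆q⇒p∪q≡q {p} {q} p⊆q =
    ⊆-antisym (λ i∈ → [ p⊆q , (λ i∈q → i∈q) ]′ (x∈p∪q⁻ p q i∈)) (q⊆p∪q p q)

  x∉p-x : (p : Subset n) (x : Fin n) → x ∉ p -ₛ x
  x∉p-x p x x∈ = x∈p─q⇒x∉q p ⁅ x ⁆ x∈ (x∈⁅x⁆ x)

  p-x∪p≡p : (p : Subset n) (x : Fin n) → (p -ₛ x) ∪ p ≡ p
  p-x∪p≡p p x = p⊆q⇒p∪q≡q (p─q⊆p p ⁅ x ⁆)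

  p∩[q-x]≡p-x : {p q : Subset n} (x : Fin n) → p ⊆ q → p ∩ (q -ₛ x) ≡ p -ₛ x
  p∩[q-x]≡p-x {p} {q} x p⊆q = ⊆-antisym
    (λ i∈ → let i∈p , i∈q-x = x∈p∩q⁻ p (q -ₛ x) i∈ in
      x∈p∧x∉q⇒x∈p─q i∈p (x∈p─q⇒x∉q q ⁅ x ⁆ i∈q-x))
    (λ i∈ → x∈p∩q⁺ (p─q⊆p p ⁅ x ⁆ i∈ ,
      x∈p∧x∉q⇒x∈p─q (p⊆q (p─q⊆p p ⁅ x ⁆ i∈)) (x∈p─q⇒x∉q p ⁅ x ⁆ i∈)))

  p∪[q-x]≡q : {p q : Subset n} {x : Fin n} → p ⊆ q → x ∈ p → p ∪ (q -ₛ x) ≡ q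
  p∪[q-x]≡q {p} {q} {x} p⊆q x∈p = ⊆-antisym
    (λ i∈ → [ p⊆q , p─q⊆p q ⁅ x ⁆ ]′ (x∈p∪q⁻ p (q -ₛ x) i∈))
    q⊆
    where
    q⊆ : q ⊆ p ∪ (q -ₛ x)
    q⊆ {i} i∈q with i ∈? ⁅ x ⁆
    ... | yes i∈x = p⊆p∪q (q -ₛ x) (≡.subst (_∈ p) (≡.sym (x∈⁅y⁆⇒x≡y x i∈x)) x∈p)
    ... | no  i∉x = q⊆p∪q p (q -ₛ x) (x∈p∧x∉q⇒x∈p─q i∈q i∉x)

  ⁅x⁆∪[p-x]≡p : {p : Subset n} {x : Fin n} → x ∈ p → ⁅ x ⁆ ∪ (p -ₛ x) ≡ p
  ⁅x⁆∪[p-x]≡p {p} {x} x∈p = p∪[q-x]≡q (λ i∈x → ≡.subst (_∈ p) (≡.sym (x∈⁅y⁆⇒x≡y x i∈x)) x∈p) (x∈⁅x⁆ x)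

  [⁅x⁆∪p]∩q≡p∩q : {p q : Subset n} {x : Fin n} → x ∉ q → (⁅ x ⁆ ∪ p) ∩ q ≡ p ∩ q
  [⁅x⁆∪p]∩q≡p∩q {p} {q} {x} x∉q = ⊆-antisym
    (λ i∈ → let i∈x∪p , i∈q = x∈p∩q⁻ (⁅ x ⁆ ∪ p) q i∈ in
      x∈p∩q⁺ ([ (λ i∈x → contradiction (≡.subst (_∈ q) (x∈⁅y⁆⇒x≡y x i∈x) i∈q) x∉q)
              , (λ i∈p → i∈p) ]′ (x∈p∪q⁻ ⁅ x ⁆ p i∈x∪p) , i∈q))
    (λ i∈ → let i∈p , i∈q = x∈p∩q⁻ p q i∈ in x∈p∩q⁺ (q⊆p∪q ⁅ x ⁆ p i∈p , i∈q))

  [⁅x⁆∪p]-x≡p : {p : Subset n} {x : Fin n} → x ∉ p → (⁅ x ⁆ ∪ p) -ₛ x ≡ p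
  [⁅x⁆∪p]-x≡p {p} {x} x∉p = ⊆-antisym
    (λ i∈ → [ (λ i∈x → contradiction i∈x (x∈p─q⇒x∉q (⁅ x ⁆ ∪ p) ⁅ x ⁆ i∈)) , (λ i∈p → i∈p) ]′
      (x∈p∪q⁻ ⁅ x ⁆ p (p─q⊆p (⁅ x ⁆ ∪ p) ⁅ x ⁆ i∈)))
    (λ i∈p → x∈p∧x≢y⇒x∈p-y (q⊆p∪q ⁅ x ⁆ p i∈p) λ { ≡.refl → x∉p i∈p })

  p∪[q∪r]≡q∪[p∪r] : (p q r : Subset n) → p ∪ (q ∪ r) ≡ q ∪ (p ∪ r)
  p∪[q∪r]≡q∪[p∪r] p q r = begin
    p ∪ (q ∪ r)  ≡⟨ ∪-assoc p q r ⟨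
    (p ∪ q) ∪ r  ≡⟨ ≡.cong (_∪ r) (∪-comm p q) ⟩
    (q ∪ p) ∪ r  ≡⟨ ∪-assoc q p r ⟩
    q ∪ (p ∪ r)  ∎
    where open ≡.≡-Reasoning

  ∪-distribˡ-∪ : (p q r : Subset n) → p ∪ (q ∪ r) ≡ (p ∪ q) ∪ (p ∪ r)
  ∪-distribˡ-∪ p q r = begin
    p ∪ (q ∪ r)        ≡⟨ ≡.cong (_∪ (q ∪ r)) (∪-idem p) ⟨
    (p ∪ p) ∪ (q ∪ r)  ≡⟨ ∪-assoc p p (q ∪ r) ⟩
    p ∪ (p ∪ (q ∪ r))  ≡⟨ ≡.cong (p ∪_) (p∪[q∪r]≡q∪[p∪r] p q r) ⟩
    p ∪ (q ∪ (p ∪ r))  ≡⟨ ∪-assoc p q (p ∪ r) ⟨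
    (p ∪ q) ∪ (p ∪ r)  ∎
    where open ≡.≡-Reasoning

-- The upper standardization.

module UpperStandardization (ℝ : RealNumbers) where
  open RealNumbers ℝ hiding (zero)
  open OrderedField ℝ
  open Cone ℝ
  open SetFunctions ℝ
  open RawMonoid +-rawMonoid using () renaming (_×_ to _·ℕ_)
  open IntegerCoefficients commutativeRing using (module Solver)
  open Solver using (solve; _:=_; _:+_; _:*_; _:-_; :-_; con)
  open SetoidReasoning setoid

  -- Every element is counted equally often on both sides; `step` checks this for the first one.
  ∑∈-modular : ∀ {n} (A B : Subset n) f → ∑∈ (A ∪ B) f + ∑∈ (A ∩ B) f ≈ ∑∈ A f + ∑∈ B f
  ∑∈-modular []      []      f = refl
  ∑∈-modular (a ∷ A) (b ∷ B) f = step a b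
    where
    g = λ i → f (suc i)

    interchange : ∀ p q r s → (p + q) + (r + s) ≈ (p + r) + (q + s)
    interchange = solve 4 (λ p q r s → (p :+ q) :+ (r :+ s) := (p :+ r) :+ (q :+ s)) refl

    prepend : ∀ {p q r s} → p + q ≈ r + s →
              (p + ∑∈ (A ∪ B) g) + (q + ∑∈ (A ∩ B) g) ≈ (r + ∑∈ A g) + (s + ∑∈ B g)
    prepend p+q≈r+s = trans (interchange _ _ _ _)
      (trans (+-cong p+q≈r+s (∑∈-modular A B g)) (interchange _ _ _ _))

    step : ∀ a b → ∑∈ ((a ∷ A) ∪ (b ∷ B)) f + ∑∈ ((a ∷ A) ∩ (b ∷ B)) f ≈ ∑∈ (a ∷ A) f + ∑∈ (b ∷ B) f
    step inside  inside  = prepend refl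
    step inside  outside = prepend refl
    step outside inside  = prepend (+-comm _ _)
    step outside outside = prepend refl

  ∑∈-cong : ∀ {n} (S : Subset n) {f g} → (∀ i → f i ≈ g i) → ∑∈ S f ≈ ∑∈ S g
  ∑∈-cong []            f≈g = refl
  ∑∈-cong (inside  ∷ S) f≈g = +-cong (f≈g zero) (∑∈-cong S λ i → f≈g (suc i))
  ∑∈-cong (outside ∷ S) f≈g = +-congˡ (∑∈-cong S λ i → f≈g (suc i))

  ∑∈-scale-minus : ∀ {n} (S : Subset n) c f g → ∑∈ S (λ i → c * f i - g i) ≈ c * ∑∈ S f - ∑∈ S g
  ∑∈-scale-minus []            c f g = solve 1 (λ c → con 0ℤ := c :* con 0ℤ :- con 0ℤ) refl c
  ∑∈-scale-minus (inside  ∷ S) c f g = trans (+-congˡ (∑∈-scale-minus S c _ _))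
    (solve 5 (λ c f g F G → c :* f :- g :+ (c :* F :- G) := c :* (f :+ F) :- (g :+ G)) refl
      c (f zero) (g zero) (∑∈ S λ i → f (suc i)) (∑∈ S λ i → g (suc i)))
  ∑∈-scale-minus (outside ∷ S) c f g = trans (+-congˡ (∑∈-scale-minus S c _ _))
    (solve 3 (λ c F G → con 0ℤ :+ (c :* F :- G) := c :* (con 0ℤ :+ F) :- (con 0ℤ :+ G)) refl
      c (∑∈ S λ i → f (suc i)) (∑∈ S λ i → g (suc i)))

  ∑∈-const : ∀ {n} (S : Subset n) y → ∑∈ S (λ _ → y) ≈ (∣ S ∣ ·ℕ 1#) * y
  ∑∈-const []            y = sym (zeroˡ y)
  ∑∈-const (inside  ∷ S) y = trans (+-congˡ (∑∈-const S y))
    (sym (trans (distribʳ y 1# (∣ S ∣ ·ℕ 1#)) (+-congʳ (*-identityˡ y))))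
  ∑∈-const (outside ∷ S) y = trans (+-identityˡ _) (∑∈-const S y)

  ∑∈-remove : ∀ {n} {S : Subset n} {j} f → j ∈ S → ∑∈ S f ≈ ∑∈ (S -ₛ j) f + f j
  ∑∈-remove {S = inside ∷ S} f here = begin
    f zero + ∑∈ S g                ≈⟨ solve 2 (λ p q → p :+ q := con 0ℤ :+ q :+ p) refl (f zero) (∑∈ S g) ⟩
    -- Removing the first element leaves the tail `S ─ ⊥`, which equals `S` only propositionally.
    0# + ∑∈ S g + f zero           ≡⟨ ≡.cong (λ S → 0# + ∑∈ S g + f zero) (p─⊥≡p S) ⟨
    0# + ∑∈ (S ─ ⊥) g + f zero     ∎
    where g = λ i → f (suc i)
  ∑∈-remove {S = inside ∷ S} f (there j∈S) =
    trans (+-congˡ (∑∈-remove (λ i → f (suc i)) j∈S)) (sym (+-assoc _ _ _))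
  ∑∈-remove {S = outside ∷ S} f (there j∈S) =
    trans (+-congˡ (∑∈-remove (λ i → f (suc i)) j∈S)) (sym (+-assoc _ _ _))

  module _ {n : ℕ} {M : Subset n} where

    -- The constants in `upperStd` cancel under `D`, and so does the sum over the set, by
    -- `∑∈-modular`.
    D-upperStd : ∀ (r : ℝ^𝒫 M) A B → D (upperStd r) A B ≈ D r A B
    D-upperStd r A B = begin
      D (upperStd r) A B
        ≈⟨ solve 10 (λ p q a b c k P Q α β →
             ((p :+ c :- k :+ P) :+ (q :+ c :- k :+ Q)) :- ((a :+ c :- k :+ α) :+ (b :+ c :- k :+ β))
             := (p :+ q :- (a :+ b)) :+ ((P :+ Q) :- (α :+ β)))
             refl (r (A ∪ₚ B)) (r (A ∩ₚ B)) (r A) (r B) _ _ _ _ _ _ ⟩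
      D r A B + ((∑∈ (set A ∪ set B) d + ∑∈ (set A ∩ set B) d) - (∑∈ (set A) d + ∑∈ (set B) d))
        ≈⟨ +-congˡ (trans (+-congʳ (∑∈-modular (set A) (set B) d)) (-‿inverseʳ _)) ⟩
      D r A B + 0#  ≈⟨ +-identityʳ _ ⟩
      D r A B       ∎
      where d = λ i → r (M without i) - r (whole M)

    upperStd-scale-minus : ∀ c (r r' : ℝ^𝒫 M) T →
      upperStd (λ A → c * r A - r' A) T ≈ c * upperStd r T - upperStd r' T
    upperStd-scale-minus c r r' T = trans
      (+-cong (+-congˡ (-‿cong (∑∈-scale-minus M c _ _)))
        (trans (∑∈-cong (set T) λ i →
            solve 5 (λ c p q p' q' → c :* p :- p' :- (c :* q :- q') := c :* (p :- q) :- (p' :- q'))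
              refl c (r (M without i)) (r (whole M)) (r' (M without i)) (r' (whole M)))
          (∑∈-scale-minus (set T) c _ _)))
      (solve 10 (λ c p p' κ q q' s s' t t' →
          (c :* p :- p') :+ κ :* (c :* q :- q') :- (c :* s :- s') :+ (c :* t :- t')
          := c :* (p :+ κ :* q :- s :+ t) :- (p' :+ κ :* q' :- s' :+ t'))
        refl c (r T) (r' T) _ (r (whole M)) (r' (whole M)) _ _ _ _)

    -- At M the last sum equals s - κ * rM, which cancels all the other terms.
    upperStd-whole : ∀ (r : ℝ^𝒫 M) → upperStd r (whole M) ≈ 0#
    upperStd-whole r = begin
      rM + (κ - 1#) * rM - s + ∑∈ M (λ i → r (M without i) - rM)
        ≈⟨ +-cong (+-congʳ (+-congˡ (trans ([y-z]x≈yx-zx rM κ 1#) (+-congˡ (-‿cong (*-identityˡ rM)))))) ∑d ⟩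
      rM + (κ * rM - rM) - s + (s - κ * rM)
        ≈⟨ solve 3 (λ p q s → p :+ (q :- p) :- s :+ (s :- q) := con 0ℤ) refl rM (κ * rM) s ⟩
      0# ∎
      where
      open RingProperties ring using ([y-z]x≈yx-zx)
      rM = r (whole M)
      κ = ∣ M ∣ ·ℕ 1#
      s = ∑∈ M (λ j → r (M without j))

      ∑d : ∑∈ M (λ i → r (M without i) - rM) ≈ s - κ * rM
      ∑d = begin
        ∑∈ M (λ i → r (M without i) - rM)       ≈⟨ ∑∈-cong M (λ i → +-congʳ (*-identityˡ _)) ⟨
        ∑∈ M (λ i → 1# * r (M without i) - rM)  ≈⟨ ∑∈-scale-minus M 1# _ _ ⟩
        1# * s - ∑∈ M (λ _ → rM)                ≈⟨ +-cong (*-identityˡ s) (-‿cong (∑∈-const M rM)) ⟩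
        s - κ * rM                              ∎

    -- From M to M without j, the value of r changes by `d j`, and exactly the summand `d j` drops
    -- out of the last sum.
    upperStd-without : ∀ (r : ℝ^𝒫 M) {j} → j ∈ M → upperStd r (M without j) ≈ 0#
    upperStd-without r {j} j∈M = begin
      upperStd r (M without j)
        ≈⟨ solve 5 (λ p c s X q → q :+ c :- s :+ X := p :+ c :- s :+ (X :+ (q :- p))) refl
             (r (whole M)) _ _ _ (r (M without j)) ⟩
      r (whole M) + _ - _ + (∑∈ (M -ₛ j) d + d j)  ≈⟨ +-congˡ (∑∈-remove d j∈M) ⟨
      upperStd r (whole M)                        ≈⟨ upperStd-whole r ⟩
      0#                                          ∎
      where d = λ i → r (M without i) - r (whole M)

    -- Supermodularity at B and M without j shows that deleting j from B raises f at least as much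
    -- as deleting it from M, which is a nonnegative amount. The elements of B outside A are deleted
    -- one at a time.
    supermodular⇒antitone : ∀ (f : ℝ^𝒫 M) → Supermodular M f →
      (∀ {j} → j ∈ M → f (whole M) ≤ f (M without j)) →
      ∀ A B → set A ⊆ set B → f B ≤ f A
    supermodular⇒antitone f Kf fM≤ A B A⊆B = descend B (⊂-wellFounded (set B)) A⊆B
      where
      step : ∀ B {j} → j ∈ set B → f B ≤ f (meet M (set B -ₛ j))
      step B {j} j∈B = 0≤b-a⇒a≤b (0≤-resp
          (solve 4 (λ p q b w → (w :+ p :- (b :+ q)) :+ (q :- w) := p :- b) refl
            (f B-j) (f (M without j)) (f B) (f (whole M)))
          (+-nonneg 0≤D (a≤b⇒0≤b-a (fM≤ (set⊆-relevant B j∈B)))))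
        where
        -- `meet` supplies the inclusion in M; the underlying set is still `set B -ₛ j`.
        B-j = meet M (set B -ₛ j)

        B∪ : B ∪ₚ (M without j) ≡ whole M
        B∪ = 𝒫-≡ (p∪[q-x]≡q (set⊆-relevant B) j∈B)

        B∩ : B ∩ₚ (M without j) ≡ B-j
        B∩ = 𝒫-≡ (≡.trans (p∩[q-x]≡p-x j (set⊆-relevant B))
          (≡.sym (p⊆q⇒p∩q≡p λ i∈ → set⊆-relevant B (p─q⊆p (set B) ⁅ j ⁆ i∈))))

        0≤D : 0# ≤ f (whole M) + f B-j - (f B + f (M without j))
        0≤D = ≡.subst₂ (λ P Q → 0# ≤ f P + f Q - (f B + f (M without j))) B∪ B∩
          (supermodular⇒D-nonneg Kf B (M without j))

      descend : ∀ B → Acc _⊂_ (set B) → set A ⊆ set B → f B ≤ f A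
      descend B (acc rec) A⊆B with nonempty? (set B ─ set A)
      ... | no  B─A=∅ = ≤-reflexive (reflexive (≡.cong f (𝒫-≡ (⊆-antisym B⊆A A⊆B))))
        where
        B⊆A : set B ⊆ set A
        B⊆A {i} i∈B with i ∈? set A
        ... | yes i∈A = i∈A
        ... | no  i∉A = contradiction (i , x∈p∧x∉q⇒x∈p─q i∈B i∉A) B─A=∅
      ... | yes (j , j∈B─A) = ≤-trans (step B j∈B)
          (descend B-j (rec (≡.subst (_⊂ set B) (≡.sym set-B-j) (x∈p⇒p-x⊂p j∈B))) A⊆B-j)
        where
        j∈B = p─q⊆p (set B) (set A) j∈B─A
        B-j = meet M (set B -ₛ j)
        set-B-j : set B-j ≡ set B -ₛ j
        set-B-j = p⊆q⇒p∩q≡p λ i∈ → set⊆-relevant B (p─q⊆p (set B) ⁅ j ⁆ i∈)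
        A⊆B-j : set A ⊆ set B-j
        A⊆B-j {i} i∈A = ≡.subst (i ∈_) (≡.sym set-B-j)
          (x∈p∧x≢y⇒x∈p-y (A⊆B i∈A) λ { ≡.refl → x∈p─q⇒x∉q (set B) (set A) j∈B─A i∈A })

  module _ {n : ℕ} {M N : Subset n} (r : ℝ^𝒫 M) (S : Subset n) .(S⊆N : S ⊆ N) where

    T-umod-⊆ : (S⊆M : S ⊆ M) → T-umod r (S ⟨ S⊆N ⟩) ≡ r (S ⟨ S⊆M ⟩)
    T-umod-⊆ S⊆M with S ⊆? M
    ... | yes _   = ≡.refl
    ... | no  S⊈M = contradiction (λ {i} → S⊆M {i}) S⊈M

    T-umod-⊈ : ¬ (S ⊆ M) → T-umod r (S ⟨ S⊆N ⟩) ≡ r (meet M S) - upperStd r (meet M S)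
    T-umod-⊈ S⊈M with S ⊆? M
    ... | yes S⊆M = contradiction (λ {i} → S⊆M {i}) S⊈M
    ... | no  _   = ≡.refl

-- Subsets of N in terms of subsets of M.

module UpperModularExtension (ℝ : RealNumbers) {n : ℕ} {N : Subset n} {x : Fin n} (x∈N : x ∈ N) where
  open RealNumbers ℝ hiding (zero)
  open OrderedField ℝ
  open Cone ℝ
  open UpperStandardization ℝ
  open SetFunctions ℝ
  open IntegerCoefficients commutativeRing using (module Solver)
  open Solver using (solve; _:=_; _:+_; _:*_; _:-_; :-_; con)
  open SetoidReasoning setoid

  M : Subset n
  M = N -ₛ x

  widen : 𝒫 M → 𝒫 N
  widen (A ⟨ A⊆M ⟩) = A ⟨ (λ i∈A → p─q⊆p N ⁅ x ⁆ (A⊆M i∈A)) ⟩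

  adjoin : 𝒫 M → 𝒫 N
  adjoin A = singleton x x∈N ∪ₚ widen A

  x∉𝒫M : (A : 𝒫 M) → x ∉ set A
  x∉𝒫M A x∈A = x∉p-x N x (set⊆-relevant A x∈A)

  ∈⇒adjoin : ∀ {A} → x ∈ set A → A ≡ adjoin (A ∖ x)
  ∈⇒adjoin x∈A = 𝒫-≡ (≡.sym (⁅x⁆∪[p-x]≡p x∈A))

  adjoin-∪ : ∀ A B → adjoin A ∪ₚ adjoin B ≡ adjoin (A ∪ₚ B)
  adjoin-∪ A B = 𝒫-≡ (≡.sym (∪-distribˡ-∪ ⁅ x ⁆ (set A) (set B)))

  adjoin-∩ : ∀ A B → adjoin A ∩ₚ adjoin B ≡ adjoin (A ∩ₚ B)
  adjoin-∩ A B = 𝒫-≡ (≡.sym (∪-distribˡ-∩ ⁅ x ⁆ (set A) (set B)))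

  adjoin-∪-widen : ∀ A B → adjoin A ∪ₚ widen B ≡ adjoin (A ∪ₚ B)
  adjoin-∪-widen A B = 𝒫-≡ (∪-assoc ⁅ x ⁆ (set A) (set B))

  adjoin-∩-widen : ∀ A B → adjoin A ∩ₚ widen B ≡ widen (A ∩ₚ B)
  adjoin-∩-widen A B = 𝒫-≡ ([⁅x⁆∪p]∩q≡p∩q (x∉𝒫M B))

  adjoin-∖ : ∀ A → adjoin A ∖ x ≡ A
  adjoin-∖ A = 𝒫-≡ ([⁅x⁆∪p]-x≡p (x∉𝒫M A))

  𝒫N-elim : (Q : 𝒫 N → Set) → (∀ A → Q (widen A)) → (∀ A → Q (adjoin A)) → ∀ A → Q A
  𝒫N-elim Q Qw Qa A = byCases (x ∈? set A)
    where
    byCases : Dec (x ∈ set A) → Q A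
    byCases (yes x∈A) = ≡.subst Q (≡.sym (∈⇒adjoin x∈A)) (Qa (A ∖ x))
    byCases (no  x∉A) = Qw (narrow A x∉A)

  D-sym : ∀ (f : ℝ^𝒫 N) A B → D f A B ≈ D f B A
  D-sym f A B = +-cong
    (reflexive (≡.cong₂ (λ P Q → f P + f Q) (𝒫-≡ (∪-comm (set A) (set B))) (𝒫-≡ (∩-comm (set A) (set B)))))
    (-‿cong (+-comm (f A) (f B)))

  -- As `D` is symmetric, mixed pairs need only one order. The symmetry holds up to `_≈_`, so Q has
  -- to respect that relation.
  D-elim : (Q : Carrier → Set) → (∀ {p q} → p ≈ q → Q p → Q q) → ∀ (f : ℝ^𝒫 N) →
           (∀ A B → Q (D f (widen A) (widen B))) →
           (∀ A B → Q (D f (adjoin A) (adjoin B))) →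
           (∀ A B → Q (D f (adjoin A) (widen B))) →
           ∀ A B → Q (D f A B)
  D-elim Q Q-resp f ww aa aw = 𝒫N-elim (λ A → ∀ B → Q (D f A B))
    (λ A → 𝒫N-elim (λ B → Q (D f (widen A) B)) (ww A)
      (λ B → Q-resp (D-sym f (adjoin B) (widen A)) (aw B A)))
    (λ A → 𝒫N-elim (λ B → Q (D f (adjoin A) B)) (aw A) (aa A))

  D-adjoin-adjoin : ∀ (f : ℝ^𝒫 N) A B → D f (adjoin A) (adjoin B) ≡ D (f ∘ adjoin) A B
  D-adjoin-adjoin f A B = ≡.cong₂ (λ P Q → f P + f Q - (f (adjoin A) + f (adjoin B)))
    (adjoin-∪ A B) (adjoin-∩ A B)

  D-adjoin-widen : ∀ (f : ℝ^𝒫 N) A B → D f (adjoin A) (widen B) ≡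
    f (adjoin (A ∪ₚ B)) + f (widen (A ∩ₚ B)) - (f (adjoin A) + f (widen B))
  D-adjoin-widen f A B = ≡.cong₂ (λ P Q → f P + f Q - (f (adjoin A) + f (widen B)))
    (adjoin-∪-widen A B) (adjoin-∩-widen A B)

  supermodular-restrict : ∀ {f : ℝ^𝒫 N} → Supermodular N f → Supermodular M (f ∘ widen)
  supermodular-restrict Kf A B = Kf (widen A) (widen B)

  -- The extension: linearity, values of `D`, supermodularity.

  T : ℝ^𝒫 M → ℝ^𝒫 N
  T = T-umod

  T-widen : ∀ r A → T r (widen A) ≡ r A
  T-widen r A = T-umod-⊆ r (set A) (set⊆-relevant (widen A)) (set⊆-relevant A)

  T-adjoin : ∀ r A → T r (adjoin A) ≡ r A - upperStd r A
  T-adjoin r A = ≡.trans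
    (T-umod-⊈ r (⁅ x ⁆ ∪ set A) (set⊆-relevant (adjoin A))
      λ x∪A⊆M → x∉p-x N x (x∪A⊆M (p⊆p∪q (set A) (x∈⁅x⁆ x))))
    (≡.cong (λ B → r B - upperStd r B)
      (𝒫-≡ (≡.trans ([⁅x⁆∪p]∩q≡p∩q (x∉p-x N x)) (p⊆q⇒p∩q≡p (set⊆-relevant A)))))

  T-scale-minus : ∀ c r r' A → T (λ B → c * r B - r' B) A ≈ c * T r A - T r' A
  T-scale-minus c r r' = 𝒫N-elim (λ A → T (λ B → c * r B - r' B) A ≈ c * T r A - T r' A)
    (λ A → begin
      T (λ B → c * r B - r' B) (widen A)      ≡⟨ T-widen _ A ⟩
      c * r A - r' A                          ≡⟨ ≡.cong₂ (λ p q → c * p - q) (T-widen r A) (T-widen r' A) ⟨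
      c * T r (widen A) - T r' (widen A)      ∎)
    (λ A → begin
      T (λ B → c * r B - r' B) (adjoin A)     ≡⟨ T-adjoin _ A ⟩
      c * r A - r' A - upperStd (λ B → c * r B - r' B) A
        ≈⟨ +-congˡ (-‿cong (upperStd-scale-minus c r r' A)) ⟩
      c * r A - r' A - (c * upperStd r A - upperStd r' A)
        ≈⟨ solve 5 (λ c p p' q q' → c :* p :- p' :- (c :* q :- q') := c :* (p :- q) :- (p' :- q')) refl
             c (r A) (r' A) (upperStd r A) (upperStd r' A) ⟩
      c * (r A - upperStd r A) - (r' A - upperStd r' A)
        ≡⟨ ≡.cong₂ (λ p q → c * p - q) (T-adjoin r A) (T-adjoin r' A) ⟨
      c * T r (adjoin A) - T r' (adjoin A)    ∎)

  D-T-widen-widen : ∀ r A B → D (T r) (widen A) (widen B) ≈ D r A B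
  D-T-widen-widen r A B = D-cong (λ A → reflexive (T-widen r A)) A B

  -- On sets containing x the extension is r - r_u, which is modular because r and r_u have the same
  -- `D`.
  D-T-adjoin-adjoin : ∀ r A B → D (T r) (adjoin A) (adjoin B) ≈ 0#
  D-T-adjoin-adjoin r A B = begin
    D (T r) (adjoin A) (adjoin B)              ≡⟨ D-adjoin-adjoin (T r) A B ⟩
    D (T r ∘ adjoin) A B
      ≈⟨ D-cong (λ A → trans (reflexive (T-adjoin r A)) (+-congʳ (sym (*-identityˡ _)))) A B ⟩
    D (λ A → 1# * r A - upperStd r A) A B      ≈⟨ D-scale-minus 1# r (upperStd r) A B ⟩
    1# * D r A B - D (upperStd r) A B          ≈⟨ +-cong (*-identityˡ _) (-‿cong (D-upperStd r A B)) ⟩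
    D r A B - D r A B                          ≈⟨ -‿inverseʳ _ ⟩
    0#                                         ∎

  -- Were all four values of the form r - u, the result would be zero. At the two sets without x the
  -- value is r instead, which leaves a difference of values of u.
  D-T-adjoin-widen : ∀ r A B → D (T r) (adjoin A) (widen B) ≈ upperStd r (A ∩ₚ B) - upperStd r B
  D-T-adjoin-widen r A B = begin
    D (T r) (adjoin A) (widen B)
      ≡⟨ D-adjoin-widen (T r) A B ⟩
    T r (adjoin (A ∪ₚ B)) + T r (widen (A ∩ₚ B)) - (T r (adjoin A) + T r (widen B))
      ≡⟨ ≡.cong₂ _-_ (≡.cong₂ _+_ (T-adjoin r (A ∪ₚ B)) (T-widen r (A ∩ₚ B)))
                     (≡.cong₂ _+_ (T-adjoin r A) (T-widen r B)) ⟩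
    r (A ∪ₚ B) - u (A ∪ₚ B) + r (A ∩ₚ B) - (r A - u A + r B)
      ≈⟨ solve 8 (λ p p' q q' a a' b b' →
           p :- p' :+ q :- (a :- a' :+ b) := ((p :+ q :- (a :+ b)) :- (p' :+ q' :- (a' :+ b'))) :+ (q' :- b'))
           refl (r (A ∪ₚ B)) (u (A ∪ₚ B)) (r (A ∩ₚ B)) (u (A ∩ₚ B)) (r A) (u A) (r B) (u B) ⟩
    D r A B - D u A B + (u (A ∩ₚ B) - u B)
      ≈⟨ +-congʳ (trans (+-congˡ (-‿cong (D-upperStd r A B))) (-‿inverseʳ _)) ⟩
    0# + (u (A ∩ₚ B) - u B)
      ≈⟨ +-identityˡ _ ⟩
    u (A ∩ₚ B) - u B ∎
    where u = upperStd r

  -- r_u vanishes at M and at each M without j, so the boundary condition of `supermodular⇒antitone`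
  -- holds with equality.
  upperStd-antitone : ∀ r → Supermodular M r → ∀ A B → set A ⊆ set B → upperStd r B ≤ upperStd r A
  upperStd-antitone r Kr = supermodular⇒antitone (upperStd r)
    (supermodular-transfer (λ A B → sym (D-upperStd r A B)) Kr)
    (λ j∈M → ≤-reflexive (trans (upperStd-whole r) (sym (upperStd-without r j∈M))))

  T-supermodular : ∀ r → Supermodular M r → Supermodular N (T r)
  T-supermodular r Kr = D-nonneg⇒supermodular (D-elim (0# ≤_) 0≤-resp (T r)
    (λ A B → 0≤-resp (sym (D-T-widen-widen r A B)) (supermodular⇒D-nonneg Kr A B))
    (λ A B → ≤-reflexive (sym (D-T-adjoin-adjoin r A B)))
    (λ A B → 0≤-resp (sym (D-T-adjoin-widen r A B))
      (a≤b⇒0≤b-a (upperStd-antitone r Kr (A ∩ₚ B) B (p∩q⊆q (set A) (set B))))))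

  T-supermodular⁻¹ : ∀ r → Supermodular N (T r) → Supermodular M r
  T-supermodular⁻¹ r KT = supermodular-cong (λ A → reflexive (T-widen r A)) (supermodular-restrict KT)

  -- The negative of r is treated as 0 * r - r, so that `T-scale-minus` covers it.
  T-negSupermodular : ∀ r → NegSupermodular r → NegSupermodular (T r)
  T-negSupermodular r K-r = supermodular-cong
    (λ A → trans (T-scale-minus 0# r r A) (trans (+-congʳ (zeroˡ _)) (+-identityˡ _)))
    (T-supermodular _ (proj₂ (negSupermodular⇒≼ r K-r)))

  T-negSupermodular⁻¹ : ∀ r → NegSupermodular (T r) → NegSupermodular r
  T-negSupermodular⁻¹ r K-T =
    supermodular-cong (λ A → -‿cong (reflexive (T-widen r A))) (supermodular-restrict K-T)

  T-≼ : ∀ {r r'} → r' ≼ r → T r' ≼ T r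
  T-≼ {r} {r'} (c , K) = c , supermodular-cong (T-scale-minus c r r') (T-supermodular _ K)

  ≼-restrict : ∀ {f g : ℝ^𝒫 N} → f ≼ g → (f ∘ widen) ≼ (g ∘ widen)
  ≼-restrict (c , K) = c , supermodular-restrict K

  ≼-respˡ : ∀ {f f' g : ℝ^𝒫 M} → (∀ A → f A ≈ f' A) → f ≼ g → f' ≼ g
  ≼-respˡ f≈f' (c , K) = c , supermodular-cong (λ A → +-congˡ (-‿cong (f≈f' A))) K

  ≼-respʳ : ∀ {f g g' : ℝ^𝒫 M} → (∀ A → g A ≈ g' A) → f ≼ g → f ≼ g'
  ≼-respʳ g≈g' (c , K) = c , supermodular-cong (λ A → +-congʳ (*-congˡ (g≈g' A))) K

  -- Restriction to subsets of M preserves `_≼_` and undoes `T`.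
  T-≼⁻¹ : ∀ {r r'} → T r' ≼ T r → r' ≼ r
  T-≼⁻¹ {r} {r'} Tr'≼Tr = ≼-respˡ (λ A → reflexive (T-widen r' A))
    (≼-respʳ (λ A → reflexive (T-widen r A)) (≼-restrict Tr'≼Tr))

  -- Supermodular functions below an extension.

  module _ (r : ℝ^𝒫 M) (m' : ℝ^𝒫 N) (Km' : Supermodular N m') (m'≼Tr : m' ≼ T r) where

    -- Both m' and c * T r - m' are supermodular, so `D m'` lies between 0 and c times `D (T r)`.
    tight : ∀ A B → D (T r) A B ≈ 0# → D m' A B ≈ 0#
    tight A B D≈0 = ±-nonneg⇒≈0 (supermodular⇒D-nonneg Km' A B)
      (0≤-resp (begin
        D (λ A → c * T r A - m' A) A B   ≈⟨ D-scale-minus c (T r) m' A B ⟩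
        c * D (T r) A B - D m' A B       ≈⟨ +-congʳ (trans (*-congˡ D≈0) (zeroʳ c)) ⟩
        0# - D m' A B                    ≈⟨ +-identityˡ _ ⟩
        - D m' A B                       ∎) (supermodular⇒D-nonneg (proj₂ m'≼Tr) A B))
      where c = proj₁ m'≼Tr

    r' : ℝ^𝒫 M
    r' = m' ∘ widen

    -- The deviation of m' from the extension of its own restriction. The factor 1 gives it the
    -- shape required by `D-scale-minus`.
    g : ℝ^𝒫 N
    g A = 1# * m' A - T r' A

    g-widen : ∀ A → g (widen A) ≈ 0#
    g-widen A = trans (+-cong (*-identityˡ _) (-‿cong (reflexive (T-widen r' A)))) (-‿inverseʳ _)

    Dg≈0 : ∀ A B → D m' A B ≈ 0# → D (T r') A B ≈ 0# → D g A B ≈ 0#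
    Dg≈0 A B D≈0 D'≈0 = begin
      D g A B                          ≈⟨ D-scale-minus 1# m' (T r') A B ⟩
      1# * D m' A B - D (T r') A B     ≈⟨ +-cong (trans (*-identityˡ _) D≈0) (-‿cong D'≈0) ⟩
      0# - 0#                          ≈⟨ -‿inverseʳ 0# ⟩
      0#                               ∎

    D-g∘adjoin : ∀ A B → D (g ∘ adjoin) A B ≈ 0#
    D-g∘adjoin A B = trans (reflexive (≡.sym (D-adjoin-adjoin g A B)))
      (Dg≈0 _ _ (tight _ _ (D-T-adjoin-adjoin r A B)) (D-T-adjoin-adjoin r' A B))

    -- x∪(M∖j) and M are tight for every upper modular extension, since r_u vanishes on M and M∖j.
    g-without : ∀ {j} → j ∈ M → g (adjoin (whole M)) ≈ g (adjoin (M without j))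
    g-without {j} j∈M = begin
      g (adjoin (whole M))
        ≡⟨ ≡.cong (g ∘ adjoin) M-j∪M ⟨
      g (adjoin (M-j ∪ₚ whole M))
        ≈⟨ solve 4 (λ p q a b → p := (p :+ q :- (a :+ b)) :+ (a :+ b :- q)) refl _ _ _ _ ⟩
      (g (adjoin (M-j ∪ₚ whole M)) + g (widen (M-j ∩ₚ whole M)) - (g (adjoin M-j) + g (widen (whole M))))
        + (g (adjoin M-j) + g (widen (whole M)) - g (widen (M-j ∩ₚ whole M)))
        ≈⟨ +-cong (trans (reflexive (≡.sym (D-adjoin-widen g M-j (whole M))))
                    (Dg≈0 _ _ (tight _ _ (D≈0 r)) (D≈0 r')))
                  (+-cong (+-congˡ (g-widen (whole M))) (-‿cong (g-widen (M-j ∩ₚ whole M)))) ⟩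
      0# + (g (adjoin M-j) + 0# - 0#)
        ≈⟨ solve 1 (λ a → con 0ℤ :+ (a :+ con 0ℤ :- con 0ℤ) := a) refl _ ⟩
      g (adjoin M-j) ∎
      where
      M-j = M without j

      M-j∪M : M-j ∪ₚ whole M ≡ whole M
      M-j∪M = 𝒫-≡ (p-x∪p≡p M j)

      D≈0 : ∀ r → D (T r) (adjoin M-j) (widen (whole M)) ≈ 0#
      D≈0 r = begin
        D (T r) (adjoin M-j) (widen (whole M))                      ≈⟨ D-T-adjoin-widen r M-j (whole M) ⟩
        upperStd r (M-j ∩ₚ whole M) - upperStd r (whole M)
          ≡⟨ ≡.cong (λ A → upperStd r A - upperStd r (whole M)) (𝒫-≡ (p⊆q⇒p∩q≡p (p─q⊆p M ⁅ j ⁆))) ⟩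
        upperStd r M-j - upperStd r (whole M)
          ≈⟨ +-cong (upperStd-without r j∈M) (-‿cong (upperStd-whole r)) ⟩
        0# - 0#                                                     ≈⟨ -‿inverseʳ 0# ⟩
        0#                                                          ∎

    -- `g ∘ adjoin` is modular and, by `g-without`, satisfies the boundary condition of
    -- `supermodular⇒antitone` with equality. The lemma thus applies to it and to its negative,
    -- which gives both inequalities.
    g-adjoin : ∀ A → g (adjoin A) ≈ g (adjoin (whole M))
    g-adjoin A = antisym
      (0≤b-a⇒a≤b (0≤-resp (solve 2 (λ p q → :- p :- (:- q) := q :- p) refl _ _) (a≤b⇒0≤b-a
        (supermodular⇒antitone (λ A → - g (adjoin A))
          (D-nonneg⇒supermodular λ A B → ≤-reflexive (sym
            (trans (D-neg (g ∘ adjoin) A B) (trans (-‿cong (D-g∘adjoin A B)) -0≈0))))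
          (λ j∈M → ≤-reflexive (-‿cong (g-without j∈M)))
          A (whole M) (set⊆-relevant A)))))
      (supermodular⇒antitone (g ∘ adjoin)
        (D-nonneg⇒supermodular λ A B → ≤-reflexive (sym (D-g∘adjoin A B)))
        (λ j∈M → ≤-reflexive (g-without j∈M))
        A (whole M) (set⊆-relevant A))
      where
      -0≈0 : - 0# ≈ 0#
      -0≈0 = trans (sym (+-identityˡ _)) (-‿inverseʳ 0#)

    -- Being 0 on sets without x and constant on sets with x, g is a multiple of the indicator of x.
    g-modular : ∀ A B → D g A B ≈ 0#
    g-modular = D-elim (_≈ 0#) (λ p≈q p≈0 → trans (sym p≈q) p≈0) g
      (λ A B → trans (D-cong g-widen A B) (D-zero A B))
      (λ A B → trans (reflexive (D-adjoin-adjoin g A B)) (D-g∘adjoin A B))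
      (λ A B → begin
        D g (adjoin A) (widen B)  ≡⟨ D-adjoin-widen g A B ⟩
        g (adjoin (A ∪ₚ B)) + g (widen (A ∩ₚ B)) - (g (adjoin A) + g (widen B))
          ≈⟨ +-cong (+-cong (g-adjoin (A ∪ₚ B)) (g-widen (A ∩ₚ B)))
               (-‿cong (+-cong (g-adjoin A) (g-widen B))) ⟩
        s + 0# - (s + 0#)         ≈⟨ -‿inverseʳ _ ⟩
        0#                        ∎)
      where s = g (adjoin (whole M))

    D-T-restrict : ∀ A B → D m' A B ≈ D (T r') A B
    D-T-restrict A B = begin
      D m' A B                                     ≈⟨ solve 2 (λ p q → p := p :- q :+ q) refl _ _ ⟩
      D m' A B - D (T r') A B + D (T r') A B       ≈⟨ +-congʳ (+-congʳ (*-identityˡ _)) ⟨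
      1# * D m' A B - D (T r') A B + D (T r') A B
        ≈⟨ +-congʳ (trans (sym (D-scale-minus 1# m' (T r') A B)) (g-modular A B)) ⟩
      0# + D (T r') A B                            ≈⟨ +-identityˡ _ ⟩
      D (T r') A B                                 ∎

  -- Transfer of extremality.

  T-criterion : ∀ r → ExtremeCriterion r → ExtremeCriterion (T r)
  T-criterion r (Kr , ¬K-r , below) =
    T-supermodular r Kr , (λ K-T → ¬K-r (T-negSupermodular⁻¹ r K-T)) , belowT
    where
    belowT : ∀ m' → Supermodular N m' → m' ≼ T r → NegSupermodular m' ⊎ T r ≼ m'
    -- The criterion for r is applied to the restriction of m'. The extension of that restriction
    -- has the same `D` as m', so either outcome carries over to m'.
    belowT m' Km' m'≼Tr = Sum.map
      (λ K-r' → supermodular-transfer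
        (λ A B → trans (D-neg (T r'') A B) (trans (-‿cong (sym (D≈ A B))) (sym (D-neg m' A B))))
        (T-negSupermodular r'' K-r'))
      (λ r≼r' → let c , K = T-≼ r≼r' in c , supermodular-transfer
        (λ A B → trans (D-scale-minus c (T r'') (T r) A B)
          (trans (+-congʳ (*-congˡ (sym (D≈ A B)))) (sym (D-scale-minus c m' (T r) A B)))) K)
      (below r'' (supermodular-restrict Km')
        (≼-respʳ (λ A → reflexive (T-widen r A)) (≼-restrict m'≼Tr)))
      where
      r'' = m' ∘ widen
      D≈ = D-T-restrict r m' Km' m'≼Tr

  -- A function below r extends to one below `T r`; the outcome there is read back by restriction.
  T-criterion⁻¹ : ∀ r → ExtremeCriterion (T r) → ExtremeCriterion r
  T-criterion⁻¹ r (KT , ¬K-T , below) =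
    T-supermodular⁻¹ r KT , (λ K-r → ¬K-T (T-negSupermodular r K-r)) , λ r' Kr' r'≼r →
      Sum.map (T-negSupermodular⁻¹ r') T-≼⁻¹ (below (T r') (T-supermodular r' Kr') (T-≼ r'≼r))

  -- The induced independency model.

  module _ (r : ℝ^𝒫 M) (t : Triplet N) where
    open Triplet t

    aC∪bC≡abC : aC ∪ₚ bC ≡ abC
    aC∪bC≡abC = 𝒫-≡ (≡.trans (∪-assoc ⁅ a ⁆ (set C) (set bC))
      (≡.cong (⁅ a ⁆ ∪_) (p⊆q⇒p∪q≡q (q⊆p∪q ⁅ b ⁆ (set C)))))

    -- As a differs from b and is not in `C`, it contributes nothing to the intersection with `bC`.
    aC∩bC≡C : aC ∩ₚ bC ≡ C
    aC∩bC≡C = 𝒫-≡ (≡.trans ([⁅x⁆∪p]∩q≡p∩q a∉bC) (p⊆q⇒p∩q≡p (q⊆p∪q ⁅ b ⁆ (set C))))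
      where
      a∉bC : a ∉ set bC
      a∉bC a∈bC = [ (λ a∈b → a≢b (x∈⁅y⁆⇒x≡y b a∈b)) , a∉C ]′ (x∈p∪q⁻ ⁅ b ⁆ (set C) a∈bC)

    triplet-D : ∀ (f : ℝ^𝒫 N) → f abC + f C - f aC - f bC ≈ D f aC bC
    triplet-D f = begin
      f abC + f C - f aC - f bC
        ≈⟨ solve 4 (λ p q a b → p :+ q :- a :- b := p :+ q :- (a :+ b)) refl _ _ _ _ ⟩
      f abC + f C - (f aC + f bC)
        ≡⟨ ≡.cong₂ (λ P Q → f P + f Q - (f aC + f bC)) aC∪bC≡abC aC∩bC≡C ⟨
      D f aC bC                   ∎

    -- Both `aC` and `bC` contain x, and `D (T r)` vanishes on such pairs.
    x∈C⇒independent : x ∈ set C → Independent (T r) t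
    x∈C⇒independent x∈C = begin
      T r abC + T r C - T r aC - T r bC          ≈⟨ triplet-D (T r) ⟩
      D (T r) aC bC
        ≡⟨ ≡.cong₂ (D (T r)) (∈⇒adjoin (q⊆p∪q ⁅ a ⁆ (set C) x∈C))
                             (∈⇒adjoin (q⊆p∪q ⁅ b ⁆ (set C) x∈C)) ⟩
      D (T r) (adjoin (aC ∖ x)) (adjoin (bC ∖ x)) ≈⟨ D-T-adjoin-adjoin r (aC ∖ x) (bC ∖ x) ⟩
      0#                                         ∎

    -- One of `aC` and `bC` contains x, and the other is B, which is `abC` without x. By symmetry of
    -- `D` the cases x = a and x = b become one.
    triplet-D-edge : ∀ B (x∉C : x ∉ set C) → abC ≡ adjoin B → set C ⊆ set B →
      (aC ≡ adjoin (narrow C x∉C) × bC ≡ widen B) ⊎ (aC ≡ widen B × bC ≡ adjoin (narrow C x∉C)) →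
      T r abC + T r C - T r aC - T r bC ≈ upperStd r (narrow C x∉C) - upperStd r (abC ∖ x)
    triplet-D-edge B x∉C abC≡ C⊆B aC,bC = begin
      T r abC + T r C - T r aC - T r bC                  ≈⟨ triplet-D (T r) ⟩
      D (T r) aC bC                                      ≈⟨ orient aC,bC ⟩
      D (T r) (adjoin C') (widen B)                      ≈⟨ D-T-adjoin-widen r C' B ⟩
      upperStd r (C' ∩ₚ B) - upperStd r B
        ≡⟨ ≡.cong₂ (λ P Q → upperStd r P - upperStd r Q) (𝒫-≡ (p⊆q⇒p∩q≡p C⊆B))
             (≡.sym (≡.trans (≡.cong (_∖ x) abC≡) (adjoin-∖ B))) ⟩
      upperStd r C' - upperStd r (abC ∖ x)               ∎
      where
      C' = narrow C x∉C

      orient : (aC ≡ adjoin C' × bC ≡ widen B) ⊎ (aC ≡ widen B × bC ≡ adjoin C') →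
               D (T r) aC bC ≈ D (T r) (adjoin C') (widen B)
      orient (inj₁ (aC≡ , bC≡)) = reflexive (≡.cong₂ (D (T r)) aC≡ bC≡)
      orient (inj₂ (aC≡ , bC≡)) =
        trans (reflexive (≡.cong₂ (D (T r)) aC≡ bC≡)) (D-sym (T r) (widen B) (adjoin C'))

    triplet-D-∈ab : ∀ (x∈ab : x ∈ ⁅ a ⁆ ∪ ⁅ b ⁆) → let x∉C = x∈ab⇒x∉C x∈ab in
      T r abC + T r C - T r aC - T r bC ≈ upperStd r (narrow C x∉C) - upperStd r (abC ∖ x)
    triplet-D-∈ab x∈ab = [ x∈a , x∈b ]′ (x∈p∪q⁻ ⁅ a ⁆ ⁅ b ⁆ x∈ab)
      where
      x∉C = x∈ab⇒x∉C x∈ab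

      x∉yC : ∀ {y} → x ≢ y → x ∉ ⁅ y ⁆ ∪ set C
      x∉yC {y} x≢y x∈yC = [ (λ x∈y → x≢y (x∈⁅y⁆⇒x≡y y x∈y)) , x∉C ]′ (x∈p∪q⁻ ⁅ y ⁆ (set C) x∈yC)

      x∈a : x ∈ ⁅ a ⁆ → T r abC + T r C - T r aC - T r bC ≈ upperStd r (narrow C x∉C) - upperStd r (abC ∖ x)
      x∈a x∈a = triplet-D-edge (narrow bC (x∉yC x≢b)) x∉C
        (𝒫-≡ (≡.cong (λ y → ⁅ y ⁆ ∪ set bC) a≡x)) (q⊆p∪q ⁅ b ⁆ (set C))
        (inj₁ (𝒫-≡ (≡.cong (λ y → ⁅ y ⁆ ∪ set C) a≡x) , ≡.refl))
        where
        a≡x = ≡.sym (x∈⁅y⁆⇒x≡y a x∈a)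
        x≢b : x ≢ b
        x≢b x≡b = a≢b (≡.trans a≡x x≡b)

      x∈b : x ∈ ⁅ b ⁆ → T r abC + T r C - T r aC - T r bC ≈ upperStd r (narrow C x∉C) - upperStd r (abC ∖ x)
      x∈b x∈b = triplet-D-edge (narrow aC (x∉yC x≢a)) x∉C
        -- In `abC` the singleton of b stands second, so it is first moved to the front.
        (𝒫-≡ (≡.trans (p∪[q∪r]≡q∪[p∪r] ⁅ a ⁆ ⁅ b ⁆ (set C)) (≡.cong (λ y → ⁅ y ⁆ ∪ set aC) b≡x)))
        (q⊆p∪q ⁅ a ⁆ (set C))
        (inj₂ (≡.refl , 𝒫-≡ (≡.cong (λ y → ⁅ y ⁆ ∪ set C) b≡x)))
        where
        b≡x = ≡.sym (x∈⁅y⁆⇒x≡y b x∈b)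
        x≢a : x ≢ a
        x≢a x≡a = a≢b (≡.sym (≡.trans b≡x x≡a))

    -- On sets without x the extension is r, and the sets of the narrowed triplet widen
    -- definitionally to the original ones.
    triplet-D-narrow : ∀ (x∉abC : x ∉ set abC) → let module t' = Triplet (narrowTriplet t x∉abC) in
      T r abC + T r C - T r aC - T r bC ≡ r t'.abC + r t'.C - r t'.aC - r t'.bC
    triplet-D-narrow x∉abC = ≡.cong₂ _-_
      (≡.cong₂ _-_ (≡.cong₂ _+_ (T-widen r t'.abC) (T-widen r t'.C)) (T-widen r t'.aC)) (T-widen r t'.bC)
      where module t' = Triplet (narrowTriplet t x∉abC)

    T-independent :
      Independent (T r) t ⇔
         ( x ∈ set C
         ⊎ (Σ[ x∈ab ∈ x ∈ ⁅ a ⁆ ∪ ⁅ b ⁆ ]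
              upperStd r (abC ∖ x) ≈ upperStd r (narrow C (x∈ab⇒x∉C x∈ab)))
         ⊎ (Σ[ x∉abC ∈ x ∉ set abC ]
              Independent r (narrowTriplet t x∉abC)))
    T-independent = mk⇔ to from
      where
      to : Independent (T r) t → _
      to ind with x ∈? set C
      ... | yes x∈C = inj₁ x∈C
      ... | no  x∉C with x ∈? (⁅ a ⁆ ∪ ⁅ b ⁆)
      ...   | yes x∈ab = inj₂ (inj₁ (x∈ab , sym (x-y≈0⇒x≈y (trans (sym (triplet-D-∈ab x∈ab)) ind))))
        where
        x-y≈0⇒x≈y : ∀ {p q} → p - q ≈ 0# → p ≈ q
        x-y≈0⇒x≈y {p} {q} p-q≈0 = trans (solve 2 (λ p q → p := p :- q :+ q) refl p q)
          (trans (+-congʳ p-q≈0) (+-identityˡ q))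
      ...   | no  x∉ab = inj₂ (inj₂ (x∉abC , trans (sym (reflexive (triplet-D-narrow x∉abC))) ind))
        where
        x∉abC : x ∉ set abC
        x∉abC x∈abC = [ (λ x∈a → x∉ab (p⊆p∪q ⁅ b ⁆ x∈a))
                      , (λ x∈bC → [ (λ x∈b → x∉ab (q⊆p∪q ⁅ a ⁆ ⁅ b ⁆ x∈b)) , x∉C ]′
                                  (x∈p∪q⁻ ⁅ b ⁆ (set C) x∈bC))
                      ]′ (x∈p∪q⁻ ⁅ a ⁆ (set bC) x∈abC)

      from : _ → Independent (T r) t
      from (inj₁ x∈C) = x∈C⇒independent x∈C
      from (inj₂ (inj₁ (x∈ab , u≈u'))) =
        trans (triplet-D-∈ab x∈ab) (trans (+-congʳ (sym u≈u')) (-‿inverseʳ _))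
      from (inj₂ (inj₂ (x∉abC , ind))) = trans (reflexive (triplet-D-narrow x∉abC)) ind

open import Data.Fin.Subset using (_-_)

mainTheorem8 :
  (ℝ : RealNumbers) →
  let open RealNumbers ℝ using (_≈_)
      open SetFunctions ℝ
  in
  (n : ℕ) (N : Subset n) → 2 ≤ℕ ∣ N ∣ →
  (x : Fin n) → x ∈ N →
  let M = N - x in
  (r : ℝ^𝒫 M) →
  let m : ℝ^𝒫 N
      m = T-umod r
  in
  ((Supermodular N m ⇔ Supermodular M r) ×
   ((t : Triplet N) → let open Triplet t in
     Independent m t ⇔
       ( x ∈ set C
       ⊎ (Σ[ x∈ab ∈ x ∈ ⁅ a ⁆ ∪ ⁅ b ⁆ ]
            upperStd r (abC ∖ x) ≈ upperStd r (narrow C (x∈ab⇒x∉C x∈ab)))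
       ⊎ (Σ[ x∉abC ∈ x ∉ set abC ]
            Independent r (narrowTriplet t x∉abC))))) ×
  (Extreme M r ⇔ Extreme N m)
mainTheorem8 ℝ n N _ x x∈N r =
  (mk⇔ (T-supermodular⁻¹ r) (T-supermodular r) , T-independent r) ,
  mk⇔ (λ e → criterion⇒extreme (T r) (T-criterion r (extreme⇒criterion r e)))
      (λ e → criterion⇒extreme r (T-criterion⁻¹ r (extreme⇒criterion (T r) e)))
  where
  open Cone ℝ
  open UpperModularExtension ℝ x∈N
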